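{- Let $T$ be a non-radial tree and let $M$ be a maximum split-set of $T$. Then $i_{\operatorname{bn}}(T)\leq\gamma_{b}(T)+\left\lceil \frac{|M|+1}{3}\right\rceil$.
   Context: All graphs are finite, simple, connected. A broadcast on a connected graph $G=(V,E)$ is a function $f:V\to\{0,1,\dots,\operatorname{diam}(G)\}$ with $f(v)\le e(v)$ (the eccentricity of $v$) for all $v$ if $|V|\ge 2$, and $f(v)=1$ if $V=\{v\}$. Its cost is $\sigma(f)=\sum_{v\in V}f(v)$, and $V_f^+=\{v:f(v)>0\}$. A vertex $u$ hears $f$ from $v\in V_f^+$ if $d(u,v)\le f(v)$; $f$ is dominating if every vertex hears $f$ from some vertex of $V_f^+$. The broadcast number $\gamma_b(G)$ is the minimum cost of a dominating broadcast; a tree $T$ is radial if $\gamma_b(T)=\operatorname{rad}(T)$. A broadcast $f$ is bn-independent if every vertex $x$ that hears $f$ from more than one vertex of $V_f^+$ satisfies $d(x,u)\ge f(u)$ for all $u\in V_f^+$. It is maximal bn-independent if it is bn-independent and there is no bn-independent broadcast $g\ne f$ with $g(v)\ge f(v)$ for all $v$. $i_{\operatorname{bn}}(G)$ is the minimum cost of a maximal bn-independent broadcast on $G$. Split-sets: let $T$ be a tree with diametrical path $P$ (a path of length $\operatorname{diam}(T)$) and $M\subseteq E(P)$ with $|M|=m\ge1$; let $T_1,\dots,T_{m+1}$ be the components of $T-M$ and $P_i$ the subpath of $P$ in $T_i$. $M$ is a split-set of $T$ if each $P_i$ has even, positive length and is a diametrical path of $T_i$; a maximum split-set is a split-set of maximum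 cardinality. -}

module Defs where

open import Data.Bool using (Bool; true; false; _∧_; _∨_; not; if_then_else_)
open import Data.Nat using (ℕ; zero; suc; _+_; _*_; _≤_; _<_; _⊔_; _⊓_)
open import Data.Nat.DivMod using (_/_)
open import Data.Nat.Divisibility using (_∣_)
open import Data.Fin using (Fin; zero; suc; _≟_)
open import Data.List using (List; []; _∷_; _++_; [_]; length; map; foldr; allFin; filterᵇ; concatMap)
open import Data.Bool.ListAction using (any)
open import Data.Nat.ListAction using (sum)
open import Data.Sum using (_⊎_)
open import Data.List.Relation.Unary.All using (All)
open import Data.List.Relation.Unary.Unique.Propositional using (Unique)
open import Data.Product using (Σ; ∃; ∃-syntax; _×_; _,_)
open import Data.Unit using (⊤)
open import Data.Empty using (⊥)
open import Relation.Nullary using (¬_)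
open import Relation.Nullary.Decidable using (⌊_⌋)
open import Relation.Binary.PropositionalEquality using (_≡_; _≢_)

record Graph (N : ℕ) : Set where
  field
    adj    : Fin N → Fin N → Bool
    sym    : ∀ u v → adj u v ≡ adj v u
    irrefl : ∀ v → adj v v ≡ false
open Graph public

Adj : ℕ → Set
Adj N = Fin N → Fin N → Bool

reach : ∀ {N} → Adj N → ℕ → Fin N → Fin N → Bool
reach A zero    u v = ⌊ u ≟ v ⌋
reach {N} A (suc k) u v = reach A k u v ∨ any (λ w → A u w ∧ reach A k w v) (allFin N)

-- least j ≥ k (within fuel steps) with p j; returns k+fuel if none
search : (ℕ → Bool) → ℕ → ℕ → ℕ
search p k zero    = k
search p k (suc f) = if p k then k else search p (suc k) f

-- distance: least k with a walk of length ≤ k (correct for vertices in the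
-- same component, since then a path of length < N exists)
distA : ∀ {N} → Adj N → Fin N → Fin N → ℕ
distA {N} A u v = search (λ k → reach A k u v) 0 N

module _ {N : ℕ} (G : Graph N) where

  dist : Fin N → Fin N → ℕ
  dist = distA (adj G)

  Connected : Set
  Connected = ∀ u v → ∃[ k ] reach (adj G) k u v ≡ true

  Linked : List (Fin N) → Set
  Linked []            = ⊤
  Linked (x ∷ [])      = ⊤
  Linked (x ∷ y ∷ r)   = adj G x y ≡ true × Linked (y ∷ r)

  HasCycle : Set
  HasCycle = ∃[ x ] ∃[ xs ] (2 ≤ length xs × Unique (x ∷ xs) × Linked (x ∷ xs ++ [ x ]))

  IsTree : Set
  IsTree = Connected × ¬ HasCycle

  ecc : Fin N → ℕ
  ecc v = foldr _⊔_ 0 (map (dist v) (allFin N))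

  diam : ℕ
  diam = foldr _⊔_ 0 (map ecc (allFin N))

  Broadcast : Set
  Broadcast = Fin N → ℕ

  IsBroadcast : Broadcast → Set
  IsBroadcast f = (2 ≤ N → ∀ v → f v ≤ ecc v) × (N ≡ 1 → ∀ v → f v ≡ 1)

  cost : Broadcast → ℕ
  cost f = sum (map f (allFin N))

  Hears : Broadcast → Fin N → Fin N → Set
  Hears f u v = 0 < f v × dist u v ≤ f v

  Dominating : Broadcast → Set
  Dominating f = ∀ u → ∃[ v ] Hears f u v

  IsBroadcastNumber : ℕ → Set
  IsBroadcastNumber γ =
    (∃[ f ] (IsBroadcast f × Dominating f × cost f ≡ γ)) ×
    (∀ f → IsBroadcast f → Dominating f → γ ≤ cost f)

  BnIndependent : Broadcast → Set
  BnIndependent f =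
    IsBroadcast f ×
    (∀ x → (∃[ u ] ∃[ v ] (u ≢ v × Hears f x u × Hears f x v)) →
           ∀ w → 0 < f w → f w ≤ dist x w)

  MaximalBnIndependent : Broadcast → Set
  MaximalBnIndependent f =
    BnIndependent f ×
    (∀ g → BnIndependent g → (∀ v → f v ≤ g v) → ¬ ¬ (∀ v → g v ≡ f v))

  IsIbn : ℕ → Set
  IsIbn i =
    (∃[ f ] (MaximalBnIndependent f × cost f ≡ i)) ×
    (∀ f → MaximalBnIndependent f → i ≤ cost f)

  DiamPath : List (Fin N) → Set
  DiamPath P = Unique P × Linked P × length P ≡ suc diam

  Edge : Set
  Edge = Fin N × Fin N

  EdgeOf : List (Fin N) → Edge → Set
  EdgeOf []          e = ⊥
  EdgeOf (x ∷ [])    e = ⊥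
  EdgeOf (x ∷ y ∷ r) (u , v) = (u ≡ x × v ≡ y) ⊎ EdgeOf (y ∷ r) (u , v)

  inEdges : List Edge → Fin N → Fin N → Bool
  inEdges M u v = any (λ { (a , b) → ⌊ a ≟ u ⌋ ∧ ⌊ b ≟ v ⌋ }) M

  adjMinus : List Edge → Adj N
  adjMinus M u v = adj G u v ∧ not (inEdges M u v ∨ inEdges M v u)

  sameComp : List Edge → Fin N → Fin N → Bool
  sameComp M c u = reach (adjMinus M) N c u

  compDiam : List Edge → Fin N → ℕ
  compDiam M c =
    foldr _⊔_ 0
      (concatMap (λ u → map (λ v → distA (adjMinus M) u v)
                             (filterᵇ (sameComp M c) (allFin N)))
                 (filterᵇ (sameComp M c) (allFin N)))

  -- the subpath P_i = P ∩ T_i (T_i the component containing c) has even,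
  -- positive length and is a diametrical path of T_i
  GoodComponent : List (Fin N) → List Edge → Fin N → Set
  GoodComponent P M c =
    Σ ℕ λ ℓ → (length (filterᵇ (sameComp M c) P) ≡ suc ℓ)
             × 0 < ℓ × 2 ∣ ℓ × ℓ ≡ compDiam M c

  IsSplitSet : List Edge → Set
  IsSplitSet M =
    ∃[ P ] (DiamPath P × All (EdgeOf P) M × Unique M × 1 ≤ length M
            × (∀ c → GoodComponent P M c))

  IsMaximumSplitSet : List Edge → Set
  IsMaximumSplitSet M =
    IsSplitSet M × (∀ M' → IsSplitSet M' → length M' ≤ length M)

rad : ∀ {n} → Graph (suc n) → ℕ
rad {n} G = foldr _⊓_ (ecc G zero) (map (ecc G) (allFin (suc n)))

⌈_/3⌉ : ℕ → ℕ
⌈ a /3⌉ = (a + 2) / 3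

{-# OPTIONS --safe #-}
-- Let p 0, …, p d be a diametrical path and f an optimal dominating broadcast, of cost γ. Projecting f
-- onto the path, let K_j = [j − e_j , j + e_j] be what the vertices hanging below p j cover of the path,
-- let x_j be the rest of their total strength, and let J_j = [j − h_j , j + h_j] where h_j is the depth of
-- the branch at p j. A branch can only be deeper than what reaches into it by 3 x_j. Sweeping the path in
-- both directions, this shows that a stretch of the path all of whose edges are crossed by some K_j or J_j
-- has length at most twice the strength spent on it. So if d = 2 γ + m with m ≥ 1, then m uncrossed edges
-- can be chosen, from left to right, cutting the path into segments of length exactly twice the strength
-- spent on them; since no J_j leaves its segment they form a split-set, whence m ≤ |M|.
--
-- The centres of these segments with their radii form a dominating broadcast of cost γ with disjoint
-- balls. Adding 1 to an independent dominating set of ⌈(m + 1)/3⌉ of the m + 1 segments makes each ball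
-- touch a neighbouring one without overlapping it, which is maximal bn-independence. If d ≤ 2 γ, a single
-- ball of radius min(γ , d) around a vertex of the path suffices.
module Submission where

open import Defs hiding (sym)
open import Data.Bool using (Bool; true; false; _∧_; _∨_; not; if_then_else_; T?)
open import Data.Bool.ListAction using (any)
open import Data.Bool.Properties using (∨-zeroʳ; T-≡)
open import Data.Fin using (Fin; zero; suc)
open import Data.Fin.Properties using (injective⇒≤)
import Data.Fin.Properties as Finₚ
open import Data.List using (List; []; _∷_; _++_; [_]; length; map; foldr; allFin; filterᵇ; concatMap; tabulate; applyUpTo; lookup)
import Data.List.Membership.DecPropositional as DecMembership
open import Data.List.Membership.Propositional using (_∈_; _∉_; find; lose)
open import Data.List.Membership.Propositional.Properties
  using (∈-lookup; ∈-allFin; ∈-map⁺; ∈-map⁻; ∈-filter⁺; ∈-filter⁻; ∈-concatMap⁺; ∈-concatMap⁻; ∈-applyUpTo⁺; ∈-applyUpTo⁻)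
open import Data.List.Properties using (map-tabulate)
open import Data.List.Relation.Unary.All using (All)
import Data.List.Relation.Unary.All as All
open import Data.List.Relation.Unary.All.Properties using (¬Any⇒All¬)
import Data.List.Relation.Unary.AllPairs as AllPairs
open import Data.List.Relation.Unary.Any using (here; there)
open import Data.List.Relation.Unary.Unique.Propositional using (Unique)
open import Data.Nat
open import Data.Nat.Divisibility using (divides)
open import Data.Nat.DivMod using (m*n/n≡m; /-monoˡ-≤)
open import Data.Nat.ListAction using (sum)
open import Data.Nat.Properties
open import Data.Nat.Tactic.RingSolver using (solve)
open import Data.Product using (∃-syntax; _×_; _,_; proj₁; proj₂)
open import Data.Sum using (_⊎_; inj₁; inj₂)
open import Data.Unit using (tt)
open import Function using (_∘_; id)
open import Function.Bundles using (Equivalence)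
open import Relation.Binary.Definitions using (tri<; tri≈; tri>)
open import Relation.Binary.PropositionalEquality using (_≡_; _≢_; refl; sym; trans; cong; cong₂; subst; subst₂)
open import Relation.Nullary using (¬_; Dec; yes; no; contradiction)
open import Relation.Nullary.Decidable using (_×-dec_; _⊎-dec_; ¬?; ⌊_⌋)

-- A vertex off the path spends part of its strength on its own branch, and vertices hanging below
-- the same `p j` duplicate each other on the path. So `e j` keeps only the furthest reach along the
-- path found in branch j, and `x j` pays for the rest, including the J intervals. Those must be
-- respected too: a branch longer than the way to a cut would spoil diametrality of the segment. The
-- constant 3 bounds (2 f + 1) / f for f at least 1, where 2 f + 1 is the number of depths that a
-- vertex of strength f can serve in its branch. The exact segment lengths come from a discrete
-- intermediate value argument. Follow the position minus twice the strength spent so far. A block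
-- of crossed edges does not raise it, a free edge raises it by one; it is 0 at the start and m at
-- the end. Hence every value t below m occurs at the left end of a free edge, and the first such
-- edge after the previous cut is cut. Exactness makes the lengths even and lets the radii add up to
-- γ, so that only the increments cost extra.

-- Farkas' lemma in one step: a linear inequality follows from a sum L ≤ R of hypotheses once the
-- ring solver checks that b − a and R − L differ by the constant k, written without subtraction.
lin : ∀ k {L R a b} → L ≤ R → a + R + k ≡ b + L → a ≤ b
lin k {L} {R} {a} {b} p q = ≤-trans (m≤m+n a k) (+-cancelʳ-≤ R (a + k) b
  (≤-trans (≤-reflexive (trans (trans (+-assoc a k R) (trans (cong (a +_) (+-comm k R)) (sym (+-assoc a R k)))) q)) (+-monoʳ-≤ b p)))

infixl 6 _⊕_
_⊕_ : ∀ {a b c d} → a ≤ b → c ≤ d → a + c ≤ b + d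
_⊕_ = +-mono-≤

≡⇒≤ : ∀ {a b : ℕ} → a ≡ b → a ≤ b
≡⇒≤ = ≤-reflexive

≡⇒≥ : ∀ {a b : ℕ} → a ≡ b → b ≤ a
≡⇒≥ p = ≤-reflexive (sym p)

ind : ∀ {a} {P : Set a} → Dec P → ℕ
ind (yes _) = 1
ind (no _)  = 0

ind≤1 : ∀ {a} {P : Set a} (d : Dec P) → ind d ≤ 1
ind≤1 (yes _) = ≤-refl
ind≤1 (no _)  = z≤n

ind-yes : ∀ {a} {P : Set a} (d : Dec P) → P → 1 ≤ ind d
ind-yes (yes _) _ = ≤-refl
ind-yes (no ¬p) p = contradiction p ¬p

ind-no : ∀ {a} {P : Set a} (d : Dec P) → ¬ P → ind d ≡ 0
ind-no (yes p) ¬p = contradiction p ¬p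
ind-no (no _)  _  = refl

-- Finite sums

sumTo : (ℕ → ℕ) → ℕ → ℕ
sumTo f zero    = 0
sumTo f (suc n) = sumTo f n + f n

sumTo-mono : ∀ {f g} n → (∀ i → i < n → f i ≤ g i) → sumTo f n ≤ sumTo g n
sumTo-mono zero    _ = z≤n
sumTo-mono (suc n) h = sumTo-mono n (λ i i<n → h i (m≤n⇒m≤1+n i<n)) ⊕ h n ≤-refl

sumTo-cong : ∀ {f g} n → (∀ i → i < n → f i ≡ g i) → sumTo f n ≡ sumTo g n
sumTo-cong zero    _ = refl
sumTo-cong (suc n) h = cong₂ _+_ (sumTo-cong n (λ i i<n → h i (m≤n⇒m≤1+n i<n))) (h n ≤-refl)

sumTo-add : ∀ f g n → sumTo (λ i → f i + g i) n ≡ sumTo f n + sumTo g n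
sumTo-add f g zero    = refl
sumTo-add f g (suc n) = trans (cong (_+ (f n + g n)) (sumTo-add f g n)) (ar (sumTo f n) (sumTo g n) (f n) (g n))
  where
  ar : ∀ a b c d → a + b + (c + d) ≡ a + c + (b + d)
  ar a b c d = solve (a ∷ b ∷ c ∷ d ∷ [])

sumTo-const : ∀ c n → sumTo (λ _ → c) n ≡ n * c
sumTo-const c zero    = refl
sumTo-const c (suc n) = trans (cong (_+ c) (sumTo-const c n)) (+-comm (n * c) c)

sumTo-split : ∀ f m n → sumTo f (m + n) ≡ sumTo f m + sumTo (λ i → f (m + i)) n
sumTo-split f m zero    = trans (cong (sumTo f) (+-identityʳ m)) (sym (+-identityʳ _))
sumTo-split f m (suc n) = trans (cong (sumTo f) (+-suc m n))
  (trans (cong (_+ f (m + n)) (sumTo-split f m n)) (+-assoc (sumTo f m) _ _))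

sumTo-monoʳ : ∀ f {m n} → m ≤ n → sumTo f m ≤ sumTo f n
sumTo-monoʳ f {m} m≤n with k , refl ← m≤n⇒∃[o]m+o≡n m≤n =
  ≤-trans (m≤m+n _ _) (≡⇒≥ (sumTo-split f m k))

sumTo-term : ∀ f {m j n} → m ≤ j → j < n → sumTo f m + f j ≤ sumTo f n
sumTo-term f m≤j j<n = ≤-trans (sumTo-monoʳ f m≤j ⊕ ≤-refl) (sumTo-monoʳ f j<n)

sumTo-reverse : ∀ f n → sumTo (λ i → f (n ∸ suc i)) n ≡ sumTo f n
sumTo-reverse f zero    = refl
sumTo-reverse f (suc n) = trans (sumTo-split (λ i → f (n ∸ i)) 1 n)
  (trans (cong (f n +_) (sumTo-reverse f n)) (+-comm (f n) _))

sumTo-zero : ∀ {f} n → (∀ i → i < n → f i ≡ 0) → sumTo f n ≡ 0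
sumTo-zero n h = trans (sumTo-cong n h) (trans (sumTo-const 0 n) (*-zeroʳ n))

-- Used to regroup sums over vertices by branch: a vertex contributes a spike at its foot, and
-- exchanging two finite sums then replaces any summation over fibres.
spike : ℕ → ℕ → ℕ → ℕ
spike a c i = ind (i ≟ a) * c

spike-at : ∀ a c → spike a c a ≡ c
spike-at a c with a ≟ a
... | yes _   = +-identityʳ c
... | no  a≢a = contradiction refl a≢a

spike-off : ∀ {a c i} → i ≢ a → spike a c i ≡ 0
spike-off {a} {c} {i} i≢a with i ≟ a
... | yes i≡a = contradiction i≡a i≢a
... | no  _   = refl

sumTo-spike : ∀ a c {n} → a < n → sumTo (spike a c) n ≡ c
sumTo-spike a c {n} a<n with k , refl ← m≤n⇒∃[o]m+o≡n a<n =
  trans (sumTo-split (spike a c) (suc a) k)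
    (trans (cong₂ _+_ (cong₂ _+_ (sumTo-zero a (λ i i<a → spike-off (<⇒≢ i<a))) (spike-at a c))
                      (sumTo-zero k (λ i _ → spike-off {a} {c} (m≢1+m+n a ∘ sym))))
           (+-identityʳ c))

-- The induction carries a second bound, `n ∸ lo`. When `n` itself is counted, this one yields the
-- bound `m`, because `n` is below `lo + m`.
count-interval : ∀ {P : ℕ → Set} (P? : ∀ k → Dec (P k)) lo m →
  (∀ k → P k → lo ≤ k × k < lo + m) → ∀ n → sumTo (λ k → ind (P? k)) n ≤ m
count-interval P? lo m inside n = proj₁ (go n)
  where
  go : ∀ n → sumTo (λ k → ind (P? k)) n ≤ m × sumTo (λ k → ind (P? k)) n ≤ n ∸ lo
  go zero    = z≤n , z≤n
  go (suc n) with go n | P? n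
  ... | u , v | no _  rewrite +-identityʳ (sumTo (λ k → ind (P? k)) n) = u , ≤-trans v (∸-monoˡ-≤ lo (n≤1+n n))
  ... | u , v | yes p rewrite +-comm (sumTo (λ k → ind (P? k)) n) 1 =
    let lo≤n , n<hi = inside n p in
    ≤-trans (s≤s v) (≤-trans (≡⇒≥ (+-∸-assoc 1 lo≤n)) (m≤n+o⇒m∸n≤o (suc n) lo n<hi)) ,
    ≤-trans (s≤s v) (≡⇒≥ (+-∸-assoc 1 lo≤n))

sumF : ∀ {n} → (Fin n → ℕ) → ℕ
sumF {n} f = sum (tabulate f)

sum-allFin : ∀ {n} (f : Fin n → ℕ) → sum (map f (allFin n)) ≡ sumF f
sum-allFin f = cong sum (map-tabulate id f)

sumF-mono : ∀ {n} {f g : Fin n → ℕ} → (∀ v → f v ≤ g v) → sumF f ≤ sumF g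
sumF-mono {zero}  _ = z≤n
sumF-mono {suc n} h = h zero ⊕ sumF-mono (h ∘ suc)

sumF-cong : ∀ {n} {f g : Fin n → ℕ} → (∀ v → f v ≡ g v) → sumF f ≡ sumF g
sumF-cong h = ≤-antisym (sumF-mono (≡⇒≤ ∘ h)) (sumF-mono (≡⇒≥ ∘ h))

sumF-zero : ∀ {n} {f : Fin n → ℕ} → (∀ v → f v ≡ 0) → sumF f ≡ 0
sumF-zero {zero}  _ = refl
sumF-zero {suc n} h = cong₂ _+_ (h zero) (sumF-zero (h ∘ suc))

sumF-add : ∀ {n} (f g : Fin n → ℕ) → sumF (λ v → f v + g v) ≡ sumF f + sumF g
sumF-add {zero}  f g = refl
sumF-add {suc n} f g = trans (cong (f zero + g zero +_) (sumF-add (f ∘ suc) (g ∘ suc)))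
  (ar (f zero) (g zero) (sumF (f ∘ suc)) (sumF (g ∘ suc)))
  where
  ar : ∀ a b c d → a + b + (c + d) ≡ a + c + (b + d)
  ar a b c d = solve (a ∷ b ∷ c ∷ d ∷ [])

sumF-scale : ∀ {n} c (f : Fin n → ℕ) → sumF (λ v → c * f v) ≡ c * sumF f
sumF-scale {zero}  c f = sym (*-zeroʳ c)
sumF-scale {suc n} c f = trans (cong (c * f zero +_) (sumF-scale c (f ∘ suc))) (sym (*-distribˡ-+ c (f zero) _))

sumF-term : ∀ {n} (f : Fin n → ℕ) v → f v ≤ sumF f
sumF-term f zero    = m≤m+n _ _
sumF-term f (suc v) = ≤-trans (sumF-term (f ∘ suc) v) (m≤n+m _ _)

sumF-single : ∀ {n} (f : Fin n → ℕ) a → (∀ v → v ≢ a → f v ≡ 0) → sumF f ≡ f a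
sumF-single f zero    h = trans (cong (f zero +_) (sumF-zero (λ v → h (suc v) λ ()))) (+-identityʳ _)
sumF-single f (suc a) h = cong₂ _+_ (h zero λ ()) (sumF-single (f ∘ suc) a (λ v v≢a → h (suc v) (v≢a ∘ Finₚ.suc-injective)))

sumTo-sumF-swap : ∀ {n} (f : ℕ → Fin n → ℕ) m → sumTo (λ i → sumF (f i)) m ≡ sumF (λ v → sumTo (λ i → f i v) m)
sumTo-sumF-swap {n} f zero    = sym (sumF-zero {n} (λ _ → refl))
sumTo-sumF-swap {n} f (suc m) = trans (cong (_+ sumF (f m)) (sumTo-sumF-swap f m)) (sym (sumF-add _ (f m)))

argmax : ∀ {n} → Fin n → (f : Fin n → ℕ) → ∃[ a ] ∀ v → f v ≤ f a
argmax {suc zero}    _ f = zero , λ { zero → ≤-refl }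
argmax {suc (suc n)} _ f with argmax zero (f ∘ suc)
... | a , h with ≤-total (f zero) (f (suc a))
... | inj₁ p = suc a , λ { zero → p ; (suc v) → h v }
... | inj₂ p = zero  , λ { zero → ≤-refl ; (suc v) → ≤-trans (h v) p }

-- Intervals covering the edges of a line

-- Crosses e i g: the interval [i − e i , i + e i] contains both ends of the edge (g , g + 1).
CrossesRight CrossesLeft Crosses : (ℕ → ℕ) → ℕ → ℕ → Set
CrossesRight e i g = i ≤ g × g < i + e i
CrossesLeft  e i g = g < i × i ≤ g + e i
Crosses      e i g = CrossesRight e i g ⊎ CrossesLeft e i g

crossesRight? : ∀ e i g → Dec (CrossesRight e i g)
crossesRight? e i g = (i ≤? g) ×-dec (g <? i + e i)

crosses? : ∀ e i g → Dec (Crosses e i g)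
crosses? e i g = crossesRight? e i g ⊎-dec ((g <? i) ×-dec (i ≤? g + e i))

RightCrossed : (ℕ → ℕ) → ℕ → Set
RightCrossed e g = ∃[ i ] i < suc g × g < i + e i

rightCrossed? : ∀ e g → Dec (RightCrossed e g)
rightCrossed? e g = anyUpTo? (λ i → g <? i + e i) (suc g)

-- Sweep from left to right: what an earlier interval still reaches beyond `n` and the edges already
-- counted are together paid for by the radii seen so far. Counting a crossed edge uses up one unit
-- of that remaining reach.
rightCrossed-count : ∀ e n → sumTo (λ g → ind (rightCrossed? e g)) n ≤ sumTo e n
rightCrossed-count e n = proj₂ (go n)
  where
  N = sumTo (λ g → ind (rightCrossed? e g))
  X = sumTo e
  ar₁ : ∀ i ei N n X X′ → i + ei + N ≤ n + X → X ≤ X′ → i + ei + N ≤ n + X′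
  ar₁ i ei N n X X′ p q = ≤-trans p (+-monoʳ-≤ n q)
  ar₂ : ∀ i ei N n X → i + ei + N ≤ n + X → i + ei + (N + 1) ≤ suc n + X
  ar₂ i ei N n X p = lin 0 p (solve (i ∷ ei ∷ N ∷ n ∷ X ∷ []))
  ar₃ : ∀ i ei N n X → i + ei + N ≤ n + X → suc n ≤ i + ei → N + 1 ≤ X
  ar₃ i ei N n X p q = lin 0 (p ⊕ q) (solve (i ∷ ei ∷ N ∷ n ∷ X ∷ []))
  go : ∀ n → (∀ i → i < n → i + e i + N n ≤ n + X n) × N n ≤ X n
  go zero    = (λ _ ()) , z≤n
  go (suc n) with go n | rightCrossed? e n
  ... | h , N≤X | d = step d
    where
    h′ : ∀ i → i < suc n → i + e i + N n ≤ n + X (suc n)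
    h′ i i<sn with m≤n⇒m<n∨m≡n (≤-pred i<sn)
    ... | inj₁ i<n  = ar₁ i (e i) (N n) n (X n) _ (h i i<n) (m≤m+n _ _)
    ... | inj₂ refl = ≤-trans (+-monoʳ-≤ (n + e n) N≤X) (≡⇒≤ (trans (+-assoc n (e n) _) (cong (n +_) (+-comm (e n) _))))
    step : (d : Dec (RightCrossed e n)) → (∀ i → i < suc n → i + e i + (N n + ind d) ≤ suc n + X (suc n)) × N n + ind d ≤ X (suc n)
    step (yes (i , i≤n , n<)) = (λ i i<sn → ar₂ i (e i) (N n) n _ (h′ i i<sn)) , ar₃ i (e i) (N n) n _ (h′ i i≤n) n<
    step (no ¬c) = (λ i i<sn → subst (λ z → i + e i + z ≤ suc n + X (suc n)) (sym (+-identityʳ (N n))) (m≤n⇒m≤1+n (h′ i i<sn))) ,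
                   ≤-trans (≡⇒≤ (+-identityʳ (N n))) (≤-trans N≤X (m≤m+n _ _))

-- Edges in gaps (crossed by no interval of radius e) that are crossed from the left by an interval
-- of radius h ≤ 3 x + (what e reaches): consecutive gaps are three apart, unless a unit of x lies between
-- them, so the excess j + h j over the current position pays for one gap per unit of x.
module GapCount
  (b : ℕ) (e x h : ℕ → ℕ)
  (Gap : ℕ → Set) (gap? : ∀ g → Dec (Gap g))
  (below : ∀ {g i} → Gap g → i ≤ b → i ≤ g → i + e i ≤ g)
  (above : ∀ {g i} → Gap g → i ≤ b → g < i → g + e i < i)
  (reach-h : ∀ j → j ≤ b → ∃[ i ] i ≤ b × i ≤ j + e i × h j + j ≤ 3 * x j + (e i + i))
  (occupied : ∀ j → j ≤ b → 1 ≤ x j ⊎ ∃[ i ] i ≤ b × i ≤ j + e i × j ≤ i + e i × 1 ≤ e i)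
  where

  bad? : ∀ g → Dec (Gap g × RightCrossed h g)
  bad? g = gap? g ×-dec rightCrossed? h g

  N X : ℕ → ℕ
  N = sumTo (λ g → ind (bad? g))
  X = sumTo x

  Start : ℕ → Set
  Start s = s ≡ 0 ⊎ ∃[ p ] s ≡ suc p × Gap p

  -- Each counted gap is charged 3 units. Stepping past it gives back one unit of position, so a
  -- slack of 2 remains, which has to be recovered before the next gap.
  Inv : ℕ → Set
  Inv s = N s ≤ X s × (∀ j → j < s → j + h j + 3 * N s ≤ s + 2 + 3 * X s)

  inv-step : ∀ s₀ s → s₀ ≤ s → s ≤ b → Start s₀ → Inv s₀ → N s ≡ N s₀ → Gap s → Inv (suc s)
  inv-step s₀ s s₀≤s s≤b start (N≤X , old) Ns≡ gap = step (bad? s)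
    where
    ar₁ : ∀ j hj N s₀ X X′ s → j + hj + 3 * N ≤ s₀ + 2 + 3 * X → s₀ ≤ s → X + 1 ≤ X′ → j + hj + 3 * N ≤ s + 3 * X′
    ar₁ j hj N s₀ X X′ s p q r = lin 1 (p ⊕ q ⊕ (r ⊕ r ⊕ r)) (solve (j ∷ hj ∷ N ∷ s₀ ∷ X ∷ X′ ∷ s ∷ []))
    ar₂ : ∀ j hj N s₀ X X′ s i ei → j + hj + 3 * N ≤ s₀ + 2 + 3 * X → s₀ + ei ≤ i → i + ei ≤ s → 1 ≤ ei → X ≤ X′ →
      j + hj + 3 * N ≤ s + 3 * X′
    ar₂ j hj N s₀ X X′ s i ei p q r t u =
      lin 0 (p ⊕ q ⊕ r ⊕ t ⊕ t ⊕ (u ⊕ u ⊕ u)) (solve (j ∷ hj ∷ N ∷ s₀ ∷ X ∷ X′ ∷ s ∷ i ∷ ei ∷ []))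
    ar₃ : ∀ j hj N xj X X′ s i ei → hj + j ≤ 3 * xj + (ei + i) → i + ei ≤ s → N ≤ X → X + xj ≤ X′ →
      j + hj + 3 * N ≤ s + 3 * X′
    ar₃ j hj N xj X X′ s i ei p q r t =
      lin 0 (p ⊕ q ⊕ (r ⊕ r ⊕ r) ⊕ (t ⊕ t ⊕ t)) (solve (j ∷ hj ∷ N ∷ xj ∷ X ∷ X′ ∷ s ∷ i ∷ ei ∷ []))
    ar₄ : ∀ j hj N s X → j + hj + 3 * N ≤ s + 3 * X → suc s ≤ j + hj → suc (3 * N) ≤ 3 * X
    ar₄ j hj N s X p q = lin 0 (p ⊕ q) (solve (j ∷ hj ∷ N ∷ s ∷ X ∷ []))
    ar₅ : ∀ j hj N s X → j + hj + 3 * N ≤ s + 3 * X → j + hj + 3 * (N + 1) ≤ suc s + 2 + 3 * X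
    ar₅ j hj N s X p = lin 0 p (solve (j ∷ hj ∷ N ∷ s ∷ X ∷ []))
    ar₆ : ∀ j hj N s X → j + hj + 3 * N ≤ s + 3 * X → j + hj + 3 * (N + 0) ≤ suc s + 2 + 3 * X
    ar₆ j hj N s X p = lin 3 p (solve (j ∷ hj ∷ N ∷ s ∷ X ∷ []))
    X′ = X (suc s)
    X≤X′ : X s₀ ≤ X′
    X≤X′ = sumTo-monoʳ x (m≤n⇒m≤1+n s₀≤s)
    right-end : ∀ {i j} → i ≤ b → j ≤ s → i ≤ j + e i → i + e i ≤ s
    right-end {i} i≤b j≤s i≤ with i ≤? s
    ... | yes i≤s = below gap i≤b i≤s
    ... | no  i≰s = contradiction (≤-trans i≤ (+-monoˡ-≤ (e i) j≤s)) (<⇒≱ (above gap i≤b (≰⇒> i≰s)))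
    left-end : ∀ {p i} → s₀ ≡ suc p → Gap p → i ≤ b → s₀ ≤ i + e i → s₀ + e i ≤ i
    left-end {p} {i} refl gp i≤b s₀≤ with i ≤? p
    ... | yes i≤p = contradiction s₀≤ (≤⇒≯ (below gp i≤b i≤p))
    ... | no  i≰p = above gp i≤b (≰⇒> i≰p)
    -- At the next gap `s` the slack 2 is gone. Positions from `s₀` on reach beyond `s` only by 3
    -- per unit of `x`. For earlier ones the occupied point `s₀` gives either a new unit of `X`,
    -- worth 3, or an interval of positive radius between the two gaps, which forces `s` to be at
    -- least `s₀ + 2`.
    mid : ∀ j → j < suc s → j + h j + 3 * N s₀ ≤ s + 3 * X′
    mid j j<ss with j <? s₀
    ... | no j≮s₀ with i , i≤b , i≤ , hi ← reach-h j (≤-trans (≤-pred j<ss) s≤b) =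
      ar₃ j (h j) (N s₀) (x j) (X s₀) X′ s i (e i) hi (right-end i≤b (≤-pred j<ss) i≤) N≤X (sumTo-term x (≮⇒≥ j≮s₀) j<ss)
    ... | yes j<s₀ = from start
      where
      from : Start s₀ → j + h j + 3 * N s₀ ≤ s + 3 * X′
      from (inj₁ s₀≡0) = contradiction (subst (j <_) s₀≡0 j<s₀) λ ()
      from (inj₂ (p , eq , gp)) with occupied s₀ (≤-trans s₀≤s s≤b)
      ... | inj₁ 1≤x = ar₁ j (h j) (N s₀) s₀ (X s₀) X′ s (old j j<s₀) s₀≤s
              (≤-trans (+-monoʳ-≤ (X s₀) 1≤x) (sumTo-term x ≤-refl (s≤s s₀≤s)))
      ... | inj₂ (i , i≤b , i≤ , s₀≤ , 1≤e) = ar₂ j (h j) (N s₀) s₀ (X s₀) X′ s i (e i) (old j j<s₀)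
              (left-end eq gp i≤b s₀≤) (right-end i≤b s₀≤s i≤) 1≤e X≤X′
    step : (d : Dec (Gap s × RightCrossed h s)) → N s + ind d ≤ X′ × (∀ j → j < suc s → j + h j + 3 * (N s + ind d) ≤ suc s + 2 + 3 * X′)
    step (no _)  rewrite Ns≡ = ≤-trans (≡⇒≤ (+-identityʳ (N s₀))) (≤-trans N≤X X≤X′) ,
                               λ j j<ss → ar₆ j (h j) (N s₀) s X′ (mid j j<ss)
    step (yes (_ , i , i≤s , s<)) rewrite Ns≡ =
      ≤-trans (≡⇒≤ (+-comm (N s₀) 1)) (*-cancelˡ-< 3 (N s₀) X′ (ar₄ i (h i) (N s₀) s X′ (mid i i≤s) s<)) ,
      λ j j<ss → ar₅ j (h j) (N s₀) s X′ (mid j j<ss)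

  -- The invariant is kept only at positions following a gap, or at 0; in between the count of gaps
  -- does not change, so `s₀` is the last such position.
  sweep : ∀ s → s ≤ suc b → ∃[ s₀ ] s₀ ≤ s × Start s₀ × Inv s₀ × N s ≡ N s₀
  sweep zero    _ = 0 , z≤n , inj₁ refl , (z≤n , λ _ ()) , refl
  sweep (suc s) s<sb with s₀ , s₀≤s , start , inv , Ns≡ ← sweep s (≤-trans (n≤1+n s) s<sb) = extend (gap? s)
    where
    extend : Dec (Gap s) → ∃[ s₀ ] s₀ ≤ suc s × Start s₀ × Inv s₀ × N (suc s) ≡ N s₀
    extend (yes gap) = suc s , ≤-refl , inj₂ (s , refl , gap) , inv-step s₀ s s₀≤s (≤-pred s<sb) start inv Ns≡ gap , refl
    extend (no ¬gap) = s₀ , m≤n⇒m≤1+n s₀≤s , start , inv ,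
      trans (cong (N s +_) (ind-no (bad? s) (¬gap ∘ proj₁))) (trans (+-identityʳ (N s)) Ns≡)

  gap-count : ∀ s → s ≤ suc b → N s ≤ X s
  gap-count s s≤ with s₀ , s₀≤s , _ , (N≤X , _) , Ns≡ ← sweep s s≤ =
    ≤-trans (≡⇒≤ Ns≡) (≤-trans N≤X (sumTo-monoʳ x s₀≤s))

-- The reflection i ↦ b − i exchanges left and right crossings.
covered-length : ∀ b e x h →
  (∀ j → j ≤ b → ∃[ i ] i ≤ b × i ≤ j + e i × j ≤ i + e i × h j + j ≤ 3 * x j + (e i + i) × h j + i ≤ 3 * x j + (e i + j)) →
  (∀ j → j ≤ b → 1 ≤ x j ⊎ ∃[ i ] i ≤ b × i ≤ j + e i × j ≤ i + e i × 1 ≤ e i) →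
  (∀ g → g < b → ∃[ i ] i ≤ b × (Crosses e i g ⊎ Crosses h i g)) →
  b ≤ 2 * sumTo (λ i → e i + x i) (suc b)
covered-length b e x h reach-h occupied covered = total
  where
  mirror : (ℕ → ℕ) → ℕ → ℕ
  mirror f i = f (b ∸ i)

  Gap Gap′ : ℕ → Set
  Gap g  = ¬ (∃[ i ] i < suc b × Crosses e i g)
  -- Beyond the range `b ∸ suc g` truncates to 0, so the bound on `g` has to be part of the
  -- reflected predicate.
  Gap′ g = g < b × Gap (b ∸ suc g)

  gap? : ∀ g → Dec (Gap g)
  gap? g = ¬? (anyUpTo? (λ i → crosses? e i g) (suc b))

  gap′? : ∀ g → Dec (Gap′ g)
  gap′? g = (g <? b) ×-dec gap? (b ∸ suc g)

  below : ∀ {g i} → Gap g → i ≤ b → i ≤ g → i + e i ≤ g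
  below gap i≤b i≤g = ≮⇒≥ λ g< → gap (_ , s≤s i≤b , inj₁ (i≤g , g<))

  above : ∀ {g i} → Gap g → i ≤ b → g < i → g + e i < i
  above gap i≤b g<i = ≰⇒> λ i≤ → gap (_ , s≤s i≤b , inj₂ (g<i , i≤))

  reflect : ∀ {i} → i ≤ b → i + (b ∸ i) ≡ b
  reflect i≤b = m+[n∸m]≡n i≤b

  mr₁ : ∀ b i i′ g g′ → i + i′ ≡ b → suc g + g′ ≡ b → i ≤ g → g′ < i′
  mr₁ b i i′ g g′ p q r = lin 0 (≡⇒≤ q ⊕ ≡⇒≥ p ⊕ r) (solve (b ∷ i ∷ i′ ∷ g ∷ g′ ∷ []))
  mr₂ : ∀ b i i′ g g′ → i + i′ ≡ b → suc g + g′ ≡ b → g < i → i′ ≤ g′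
  mr₂ b i i′ g g′ p q r = lin 0 (≡⇒≤ p ⊕ ≡⇒≥ q ⊕ r) (solve (b ∷ i ∷ i′ ∷ g ∷ g′ ∷ []))
  mr₃ : ∀ b i i′ g g′ f → i + i′ ≡ b → suc g + g′ ≡ b → i ≤ g + f → g′ < i′ + f
  mr₃ b i i′ g g′ f p q r = lin 0 (≡⇒≤ q ⊕ ≡⇒≥ p ⊕ r) (solve (b ∷ i ∷ i′ ∷ g ∷ g′ ∷ f ∷ []))
  mr₄ : ∀ b i i′ g g′ f → i + i′ ≡ b → suc g + g′ ≡ b → i + f ≤ g → g′ + f < i′
  mr₄ b i i′ g g′ f p q r = lin 0 (≡⇒≤ q ⊕ ≡⇒≥ p ⊕ r) (solve (b ∷ i ∷ i′ ∷ g ∷ g′ ∷ f ∷ []))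
  mr₅ : ∀ b i i′ g g′ f → i + i′ ≡ b → suc g + g′ ≡ b → g + f < i → i′ + f ≤ g′
  mr₅ b i i′ g g′ f p q r = lin 0 (≡⇒≤ p ⊕ ≡⇒≥ q ⊕ r) (solve (b ∷ i ∷ i′ ∷ g ∷ g′ ∷ f ∷ []))
  mr₆ : ∀ b i i′ j j′ f → i + i′ ≡ b → j + j′ ≡ b → i ≤ j + f → j′ ≤ i′ + f
  mr₆ b i i′ j j′ f p q r = lin 0 (≡⇒≤ q ⊕ ≡⇒≥ p ⊕ r) (solve (b ∷ i ∷ i′ ∷ j ∷ j′ ∷ f ∷ []))
  mr₇ : ∀ b i i′ j j′ h x e → i + i′ ≡ b → j + j′ ≡ b → h + i ≤ 3 * x + (e + j) → h + j′ ≤ 3 * x + (e + i′)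
  mr₇ b i i′ j j′ h x e p q r = lin 0 (≡⇒≤ q ⊕ ≡⇒≥ p ⊕ r) (solve (b ∷ i ∷ i′ ∷ j ∷ j′ ∷ h ∷ x ∷ e ∷ []))

  flipped : ∀ {i} → i ≤ b → (b ∸ i) + i ≡ b
  flipped i≤b = m∸n+n≡m i≤b

  flip-edge : ∀ {g} → g < b → suc (b ∸ suc g) + g ≡ b
  flip-edge {g} g<b = trans (sym (+-suc (b ∸ suc g) g)) (flipped g<b)

  below′ : ∀ {g i} → Gap′ g → i ≤ b → i ≤ g → i + mirror e i ≤ g
  below′ {g} {i} (g<b , gap) i≤b i≤g =
    mr₅ b (b ∸ i) i (b ∸ suc g) g (e (b ∸ i)) (flipped i≤b) (flip-edge g<b)
      (above gap (m∸n≤m b i) (mr₁ b i (b ∸ i) g (b ∸ suc g) (reflect i≤b) (reflect g<b) i≤g))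

  above′ : ∀ {g i} → Gap′ g → i ≤ b → g < i → g + mirror e i < i
  above′ {g} {i} (g<b , gap) i≤b g<i =
    mr₄ b (b ∸ i) i (b ∸ suc g) g (e (b ∸ i)) (flipped i≤b) (flip-edge g<b)
      (below gap (m∸n≤m b i) (mr₂ b i (b ∸ i) g (b ∸ suc g) (reflect i≤b) (reflect g<b) g<i))

  mirror-≡ : ∀ (f : ℕ → ℕ) {i} → i ≤ b → f i ≡ mirror f (b ∸ i)
  mirror-≡ f i≤b = cong f (sym (m∸[m∸n]≡n i≤b))

  reach-h′ : ∀ j → j ≤ b → ∃[ i ] i ≤ b × i ≤ j + mirror e i × mirror h j + j ≤ 3 * mirror x j + (mirror e i + i)
  reach-h′ j j≤b with i , i≤b , i≤ , j≤ , _ , hi ← reach-h (b ∸ j) (m∸n≤m b j) =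
    b ∸ i , m∸n≤m b i ,
    subst (λ z → b ∸ i ≤ j + z) (mirror-≡ e i≤b) (mr₆ b (b ∸ j) j i (b ∸ i) (e i) (flipped j≤b) (reflect i≤b) j≤) ,
    subst (λ z → _ ≤ 3 * mirror x j + (z + (b ∸ i))) (mirror-≡ e i≤b)
      (mr₇ b i (b ∸ i) (b ∸ j) j (mirror h j) (mirror x j) (e i) (reflect i≤b) (flipped j≤b) hi)

  occupied′ : ∀ j → j ≤ b → 1 ≤ mirror x j ⊎ ∃[ i ] i ≤ b × i ≤ j + mirror e i × j ≤ i + mirror e i × 1 ≤ mirror e i
  occupied′ j j≤b with occupied (b ∸ j) (m∸n≤m b j)
  ... | inj₁ 1≤x = inj₁ 1≤x
  ... | inj₂ (i , i≤b , i≤ , j≤ , 1≤e) = inj₂ (b ∸ i , m∸n≤m b i ,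
    subst (λ z → b ∸ i ≤ j + z) (mirror-≡ e i≤b) (mr₆ b (b ∸ j) j i (b ∸ i) (e i) (flipped j≤b) (reflect i≤b) j≤) ,
    subst (λ z → j ≤ b ∸ i + z) (mirror-≡ e i≤b) (mr₆ b i (b ∸ i) (b ∸ j) j (e i) (reflect i≤b) (flipped j≤b) i≤) ,
    subst (1 ≤_) (mirror-≡ e i≤b) 1≤e)

  reach-hᴿ : ∀ j → j ≤ b → ∃[ i ] i ≤ b × i ≤ j + e i × h j + j ≤ 3 * x j + (e i + i)
  reach-hᴿ j j≤b with i , i≤b , i≤ , _ , hi , _ ← reach-h j j≤b = i , i≤b , i≤ , hi

  module R = GapCount b e x h Gap gap? below above
    reach-hᴿ occupied
  module L = GapCount b (mirror e) (mirror x) (mirror h) Gap′ gap′? below′ above′ reach-h′ occupied′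

  right-e left-e right-h left-h : ℕ → ℕ
  right-e g = ind (rightCrossed? e g)
  left-e  g = ind (rightCrossed? (mirror e) g)
  right-h g = ind (R.bad? g)
  left-h  g = ind (L.bad? g)

  left→mirror : ∀ f {i g} → i ≤ b → g < b → CrossesLeft f i g → RightCrossed (mirror f) (b ∸ suc g)
  left→mirror f {i} {g} i≤b g<b (g<i , i≤) = b ∸ i ,
    s≤s (mr₂ b i (b ∸ i) g (b ∸ suc g) (reflect i≤b) (reflect g<b) g<i) ,
    subst (λ z → b ∸ suc g < b ∸ i + z) (mirror-≡ f i≤b)
      (mr₃ b i (b ∸ i) g (b ∸ suc g) (f i) (reflect i≤b) (reflect g<b) i≤)

  -- Every edge is counted by one of four sweeps: K or J, rightwards or leftwards. An edge crossed
  -- by no K is a gap, so the J that covers it makes it bad in one of the two directions. Summed up,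
  -- each of `e` and `x` is spent twice, which is the factor 2.
  charge : ∀ g → g < b → 1 ≤ (right-e g + left-e (b ∸ suc g)) + (right-h g + left-h (b ∸ suc g))
  charge g g<b = cases (anyUpTo? (λ i → crosses? e i g) (suc b))
    where
    in-e : right-e g + left-e (b ∸ suc g) ≤ (right-e g + left-e (b ∸ suc g)) + (right-h g + left-h (b ∸ suc g))
    in-e = m≤m+n _ _
    in-h : right-h g + left-h (b ∸ suc g) ≤ (right-e g + left-e (b ∸ suc g)) + (right-h g + left-h (b ∸ suc g))
    in-h = m≤n+m _ (right-e g + left-e (b ∸ suc g))
    flip< : b ∸ suc g < b
    flip< = ∸-monoʳ-< (s≤s z≤n) g<b
    flip≡ : b ∸ suc (b ∸ suc g) ≡ g
    flip≡ = cong pred (trans (sym (+-∸-assoc 1 flip<)) (m∸[m∸n]≡n g<b))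
    cases : Dec (∃[ i ] i < suc b × Crosses e i g) → 1 ≤ (right-e g + left-e (b ∸ suc g)) + (right-h g + left-h (b ∸ suc g))
    cases (yes (i , i<sb , inj₁ (i≤g , g<))) =
      ≤-trans (ind-yes (rightCrossed? e g) (i , s≤s i≤g , g<)) (≤-trans (m≤m+n _ _) in-e)
    cases (yes (i , i<sb , inj₂ left)) =
      ≤-trans (ind-yes (rightCrossed? (mirror e) (b ∸ suc g)) (left→mirror e (≤-pred i<sb) g<b left))
        (≤-trans (m≤n+m _ (right-e g)) in-e)
    cases (no ¬c) with covered g g<b
    ... | i , i≤b , inj₁ c = contradiction (i , s≤s i≤b , c) ¬c
    ... | i , i≤b , inj₂ (inj₁ (i≤g , g<)) =
      ≤-trans (ind-yes (R.bad? g) (¬c , i , s≤s i≤g , g<)) (≤-trans (m≤m+n _ _) in-h)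
    ... | i , i≤b , inj₂ (inj₂ left) =
      ≤-trans (ind-yes (L.bad? (b ∸ suc g)) ((flip< , subst Gap (sym flip≡) ¬c) , left→mirror h i≤b g<b left))
        (≤-trans (m≤n+m _ (right-h g)) in-h)

  total : b ≤ 2 * sumTo (λ i → e i + x i) (suc b)
  total = begin
    b
      ≡⟨ *-identityʳ b ⟨
    b * 1
      ≡⟨ sumTo-const 1 b ⟨
    sumTo (λ _ → 1) b
      ≤⟨ sumTo-mono b charge ⟩
    sumTo (λ g → (right-e g + left-e (b ∸ suc g)) + (right-h g + left-h (b ∸ suc g))) b
      ≡⟨ sumTo-add _ _ b ⟩
    sumTo (λ g → right-e g + left-e (b ∸ suc g)) b + sumTo (λ g → right-h g + left-h (b ∸ suc g)) b
      ≡⟨ cong₂ _+_ (sumTo-add _ _ b) (sumTo-add _ _ b) ⟩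
    (sumTo right-e b + sumTo (λ g → left-e (b ∸ suc g)) b) + (sumTo right-h b + sumTo (λ g → left-h (b ∸ suc g)) b)
      ≡⟨ cong₂ (λ u v → sumTo right-e b + u + (sumTo right-h b + v)) (sumTo-reverse left-e b) (sumTo-reverse left-h b) ⟩
    (sumTo right-e b + sumTo left-e b) + (sumTo right-h b + sumTo left-h b)
      ≤⟨ (up e (rightCrossed-count e b) ⊕ ≤-trans (up (mirror e) (rightCrossed-count (mirror e) b)) (≡⇒≤ (sumTo-reverse e (suc b))))
         ⊕ (up x (R.gap-count b (n≤1+n b)) ⊕ ≤-trans (up (mirror x) (L.gap-count b (n≤1+n b))) (≡⇒≤ (sumTo-reverse x (suc b)))) ⟩
    (sumTo e (suc b) + sumTo e (suc b)) + (sumTo x (suc b) + sumTo x (suc b))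
      ≡⟨ ar (sumTo e (suc b)) (sumTo x (suc b)) ⟩
    2 * (sumTo e (suc b) + sumTo x (suc b))
      ≡⟨ cong (2 *_) (sumTo-add e x (suc b)) ⟨
    2 * sumTo (λ i → e i + x i) (suc b) ∎
    where
    open ≤-Reasoning
    up : ∀ f {n} → n ≤ sumTo f b → n ≤ sumTo f (suc b)
    up f p = ≤-trans p (m≤m+n _ _)
    ar : ∀ a c → (a + a) + (c + c) ≡ 2 * (a + c)
    ar a c = solve (a ∷ c ∷ [])

-- Choosing the cut edges from left to right

-- Fits a r refers to the segment [a , a + 2 r]; the last index counts the edges between consecutive segments.
data Tiling (Fits : ℕ → ℕ → Set) (d : ℕ) : ℕ → ℕ → Set where
  last : ∀ {s} r → 1 ≤ r → Fits s r → s + 2 * r ≡ d → Tiling Fits d s 0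
  cut  : ∀ {s k} r → 1 ≤ r → Fits s r → s + 2 * r < d → Tiling Fits d (suc (s + 2 * r)) k → Tiling Fits d s (suc k)

module FreeEdges
  (d : ℕ) (e x h : ℕ → ℕ)
  (h≤ : ∀ j → j ≤ d → h j ≤ j) (h+≤ : ∀ j → j ≤ d → h j + j ≤ d)
  (reach-h : ∀ j → j ≤ d → ∃[ i ] i ≤ d × i ≤ j + e i × j ≤ i + e i × h j + j ≤ 3 * x j + (e i + i) × h j + i ≤ 3 * x j + (e i + j))
  (occupied : ∀ j → j ≤ d → 1 ≤ x j ⊎ ∃[ i ] i ≤ d × i ≤ j + e i × j ≤ i + e i × 1 ≤ e i)
  where

  ρ S : ℕ → ℕ
  ρ i = e i + x i
  S = sumTo ρ

  Crossed Free Start End : ℕ → Set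
  Crossed g = ∃[ i ] i < suc d × (Crosses e i g ⊎ Crosses h i g)
  Free g    = ¬ Crossed g
  Start s   = s ≡ 0 ⊎ ∃[ p ] s ≡ suc p × Free p
  End q     = q ≡ d ⊎ Free q

  crossed? : ∀ g → Dec (Crossed g)
  crossed? g = anyUpTo? (λ i → crosses? e i g ⊎-dec crosses? h i g) (suc d)

  free-e : ∀ {g i} → Free g → i ≤ d → ¬ Crosses e i g
  free-e free i≤d c = free (_ , s≤s i≤d , inj₁ c)

  free-h : ∀ {g i} → Free g → i ≤ d → ¬ Crosses h i g
  free-h free i≤d c = free (_ , s≤s i≤d , inj₂ c)

  -- An interval that contains a point of the segment but has its centre outside would cross the
  -- edge bounding the segment, and that edge is free.
  confined : ∀ f → (∀ {g i} → Free g → i ≤ d → ¬ Crosses f i g) → ∀ {s q i j} → Start s → End q →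
    s ≤ j → j ≤ q → i ≤ d → i ≤ j + f i → j ≤ i + f i → s ≤ i × i ≤ q
  confined f uncrossed {s} {q} {i} {j} start end s≤j j≤q i≤d i≤ j≤ = left start , right end
    where
    left : Start s → s ≤ i
    left (inj₁ refl) = z≤n
    left (inj₂ (p , refl , free)) = ≰⇒> λ i≤p → uncrossed free i≤d (inj₁ (i≤p , ≤-trans s≤j j≤))
    right : End q → i ≤ q
    right (inj₁ refl) = i≤d
    right (inj₂ free) = ≮⇒≥ λ q<i → uncrossed free i≤d (inj₂ (q<i , ≤-trans i≤ (+-monoˡ-≤ (f i) j≤q)))

  -- Ensures that radii are at least 1, hence that the pieces of a split-set have positive length.
  occupied-segment : ∀ {s q} → Start s → End q → s ≤ q → q ≤ d → S s + 1 ≤ S (suc q)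
  occupied-segment {s} start end s≤q q≤d with occupied s (≤-trans s≤q q≤d)
  ... | inj₁ 1≤x = ≤-trans (+-monoʳ-≤ (S s) (≤-trans 1≤x (m≤n+m _ (e s)))) (sumTo-term ρ ≤-refl (s≤s s≤q))
  ... | inj₂ (i , i≤d , i≤ , s≤ , 1≤e) with s≤i , i≤q ← confined e free-e start end ≤-refl s≤q i≤d i≤ s≤ =
    ≤-trans (+-monoʳ-≤ (S s) (≤-trans 1≤e (m≤m+n _ (x i)))) (sumTo-term ρ s≤i (s≤s i≤q))

  abstract
   -- This is `covered-length` for the sequences shifted by `s`, with the difference of the two
   -- values of `S` written additively. It applies because, by `confined`, all intervals that matter
   -- for the segment are centred in it.
   block : ∀ s n → Start s → End (s + n) → s + n ≤ d → (∀ g → g < n → ¬ Free (s + g)) →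
     (s + n) + 2 * S s ≤ s + 2 * S (suc (s + n))
   block s n start end s+n≤d crossed = finish
     where
     e′ x′ h′ : ℕ → ℕ
     e′ k = e (s + k)
     x′ k = x (s + k)
     h′ k = h (s + k)
     sh₁ : ∀ s i j f → s + i ≤ s + j + f → i ≤ j + f
     sh₁ s i j f p = +-cancelˡ-≤ s i (j + f) (≤-trans p (≡⇒≤ (+-assoc s j f)))
     sh₂ : ∀ s i j h x f → h + (s + j) ≤ 3 * x + (f + (s + i)) → h + j ≤ 3 * x + (f + i)
     sh₂ s i j h x f p = lin 0 p (solve (s ∷ i ∷ j ∷ h ∷ x ∷ f ∷ []))
     sh₄ : ∀ s i g f → suc (s + g) ≤ s + i + f → suc g ≤ i + f
     sh₄ s i g f p = sh₁ s (suc g) i f (≤-trans (≡⇒≤ (+-suc s g)) p)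
     upto : ∀ {j} → j ≤ n → s + j ≤ s + n
     upto = +-monoʳ-≤ s
     unshift : ∀ {i} → s ≤ i → i ≤ s + n → ∃[ k ] k ≤ n × i ≡ s + k
     unshift {i} s≤i i≤ with k , refl ← m≤n⇒∃[o]m+o≡n s≤i = k , +-cancelˡ-≤ s k n i≤ , refl
     reach′ : ∀ j → j ≤ n → ∃[ i ] i ≤ n × i ≤ j + e′ i × j ≤ i + e′ i × h′ j + j ≤ 3 * x′ j + (e′ i + i) × h′ j + i ≤ 3 * x′ j + (e′ i + j)
     reach′ j j≤n with i , i≤d , i≤ , j≤ , h₁ , h₂ ← reach-h (s + j) (≤-trans (upto j≤n) s+n≤d)
                  with s≤i , i≤q ← confined e free-e start end (m≤m+n s j) (upto j≤n) i≤d i≤ j≤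
                  with k , k≤n , refl ← unshift s≤i i≤q =
       k , k≤n , sh₁ s k j (e′ k) i≤ , sh₁ s j k (e′ k) j≤ ,
       sh₂ s k j (h′ j) (x′ j) (e′ k) h₁ , sh₂ s j k (h′ j) (x′ j) (e′ k) h₂
     occupied′ : ∀ j → j ≤ n → 1 ≤ x′ j ⊎ ∃[ i ] i ≤ n × i ≤ j + e′ i × j ≤ i + e′ i × 1 ≤ e′ i
     occupied′ j j≤n with occupied (s + j) (≤-trans (upto j≤n) s+n≤d)
     ... | inj₁ p = inj₁ p
     ... | inj₂ (i , i≤d , i≤ , j≤ , 1≤e)
       with s≤i , i≤q ← confined e free-e start end (m≤m+n s j) (upto j≤n) i≤d i≤ j≤
       with k , k≤n , refl ← unshift s≤i i≤q = inj₂ (k , k≤n , sh₁ s k j (e′ k) i≤ , sh₁ s j k (e′ k) j≤ , 1≤e)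
     near : ∀ f {i g} → Crosses f i g → i ≤ g + f i × g ≤ i + f i
     near f (inj₁ (i≤g , g<)) = ≤-trans i≤g (m≤m+n _ _) , <⇒≤ g<
     near f (inj₂ (g<i , i≤)) = i≤ , ≤-trans (<⇒≤ g<i) (m≤m+n _ _)
     shift-crosses : ∀ f {k g} → Crosses f (s + k) (s + g) → Crosses (λ i → f (s + i)) k g
     shift-crosses f {k} {g} (inj₁ (k≤g , g<)) = inj₁ (+-cancelˡ-≤ s k g k≤g , sh₄ s k g _ g<)
     shift-crosses f {k} {g} (inj₂ (g<k , k≤)) = inj₂ (+-cancelˡ-< s g k g<k , sh₁ s k g _ k≤)
     covered′ : ∀ g → g < n → ∃[ i ] i ≤ n × (Crosses e′ i g ⊎ Crosses h′ i g)
     covered′ g g<n with crossed? (s + g)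
     ... | no free = contradiction free (crossed g g<n)
     ... | yes (i , i<sd , inj₁ c)
       with s≤i , i≤q ← confined e free-e start end (m≤m+n s g) (upto (<⇒≤ g<n)) (≤-pred i<sd) (proj₁ (near e c)) (proj₂ (near e c))
       with k , k≤n , refl ← unshift s≤i i≤q = k , k≤n , inj₁ (shift-crosses e c)
     ... | yes (i , i<sd , inj₂ c)
       with s≤i , i≤q ← confined h free-h start end (m≤m+n s g) (upto (<⇒≤ g<n)) (≤-pred i<sd) (proj₁ (near h c)) (proj₂ (near h c))
       with k , k≤n , refl ← unshift s≤i i≤q = k , k≤n , inj₂ (shift-crosses h c)
     ar : ∀ s n A B C → n ≤ 2 * B → C ≡ A + B → (s + n) + 2 * A ≤ s + 2 * C
     ar s n A B C p refl = lin 0 p (solve (s ∷ n ∷ A ∷ B ∷ []))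
     finish : (s + n) + 2 * S s ≤ s + 2 * S (suc (s + n))
     finish = ar s n (S s) (sumTo (λ k → ρ (s + k)) (suc n)) (S (suc (s + n)))
       (covered-length n e′ x′ h′ reach′ occupied′ covered′)
       (trans (cong S (sym (+-suc s n))) (sumTo-split ρ s (suc n)))

  Fits : ℕ → ℕ → Set
  Fits s r = ∀ j → s ≤ j → j ≤ s + 2 * r → s + h j ≤ j × h j + j ≤ s + 2 * r

  fits : ∀ {s r} → Start s → End (s + 2 * r) → s + 2 * r ≤ d → Fits s r
  fits {s} {r} start end q≤d j s≤j j≤q = left start , right end
    where
    j≤d = ≤-trans j≤q q≤d
    left : Start s → s + h j ≤ j
    left (inj₁ refl) = h≤ j j≤d
    left (inj₂ (p , refl , free)) = ≰⇒> λ j≤ → free-h free j≤d (inj₂ (s≤j , j≤))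
    right : End (s + 2 * r) → h j + j ≤ s + 2 * r
    right (inj₁ q≡d) = subst (h j + j ≤_) (sym q≡d) (h+≤ j j≤d)
    right (inj₂ free) = ≮⇒≥ λ q< → free-h free j≤d (inj₁ (j≤q , subst (s + 2 * r <_) (+-comm (h j) j) q<))

  module _ (m : ℕ) (d≡ : d ≡ 2 * S (suc d) + m) where

    NextCut : ℕ → ℕ → Set
    NextCut t s = ∃[ p ] s ≤ p × p < d × Free p × p ≡ t + 2 * S (suc p)

    scan-arith : ∀ q s A B t → q + 2 * A ≤ s + 2 * B → s ≤ t + 2 * A → q ≤ t + 2 * B
    scan-arith q s A B t p u = lin 0 (p ⊕ u) (solve (q ∷ s ∷ A ∷ B ∷ t ∷ []))

    segment-arith : ∀ s t A r C p → s ≡ t + 2 * A → A + r ≡ C → p ≡ t + 2 * C → p ≡ s + 2 * r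
    segment-arith s t A r C p refl refl refl = solve (t ∷ A ∷ r ∷ [])

    -- The edges of the current block from `s` to `s + n` are all crossed. At a free edge with left
    -- end q, `block` gives q ≤ t + 2 S (q + 1). If this is strict, a new block starts behind the
    -- edge under the same hypothesis; equality is the cut sought. Reaching `d` without equality
    -- would give d ≤ t + 2 S (d + 1), against `d≡` and `t < m`.
    scan : ∀ t s₀ → t < m → ∀ fuel s n → fuel + (s + n) ≡ d → Start s → s₀ ≤ s → s ≤ t + 2 * S s →
      (∀ g → g < n → ¬ Free (s + g)) → NextCut t s₀
    scan t s₀ t<m zero s n eq start s₀≤s s≤ crossed =
      contradiction (block s n start (inj₁ eq) (≡⇒≤ eq) crossed) λ b →
        <-irrefl refl (ar d m t (s + n) s (S s) (S (suc (s + n))) (S (suc d)) b s≤ t<m eq (cong (S ∘ suc) eq) d≡)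
      where
      ar : ∀ d m t q s A B C → q + 2 * A ≤ s + 2 * B → s ≤ t + 2 * A → t < m → q ≡ d → B ≡ C → d ≡ 2 * C + m → suc d ≤ d
      ar d m t q s A B C p u v refl refl w = lin 0 (p ⊕ u ⊕ v ⊕ ≡⇒≥ w) (solve (q ∷ m ∷ t ∷ s ∷ A ∷ B ∷ []))
    scan t s₀ t<m (suc fuel) s n eq start s₀≤s s≤ crossed with crossed? (s + n)
    ... | yes c = scan t s₀ t<m fuel s (suc n) (trans (cong (fuel +_) (+-suc s n)) (trans (+-suc fuel (s + n)) eq)) start s₀≤s s≤ more
      where
      more : ∀ g → g < suc n → ¬ Free (s + g)
      more g g<sn with m≤n⇒m<n∨m≡n (≤-pred g<sn)
      ... | inj₁ g<n  = crossed g g<n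
      ... | inj₂ refl = λ free → free c
    ... | no free with q≤ ← scan-arith (s + n) s (S s) (S (suc (s + n))) t
                          (block s n start (inj₂ free) (≤-trans (m≤n+m (s + n) (suc fuel)) (≡⇒≤ eq)) crossed) s≤
                  with m≤n⇒m<n∨m≡n q≤
    ...   | inj₁ q< = scan t s₀ t<m fuel (suc (s + n)) 0 (trans (cong (fuel +_) (+-identityʳ _)) (trans (+-suc fuel (s + n)) eq))
                        (inj₂ (s + n , refl , free)) (m≤n⇒m≤1+n (≤-trans s₀≤s (m≤m+n s n))) q< (λ _ ())
    ...   | inj₂ q≡ = s + n , ≤-trans s₀≤s (m≤m+n s n) , ≤-trans (s≤s (m≤n+m (s + n) fuel)) (≡⇒≤ eq) , free , q≡

    tiling-from : ∀ k t s → t + k ≡ m → Start s → s ≤ d → s ≡ t + 2 * S s → Tiling Fits d s k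
    -- All m cuts are made, and `d≡` says that the remaining length is exactly twice the remaining
    -- strength.
    tiling-from zero t s t≡ start s≤d s≡
      with r , r≡ ← m≤n⇒∃[o]m+o≡n (sumTo-monoʳ ρ (m≤n⇒m≤1+n s≤d)) =
      last r (pos (occupied-segment start (inj₁ refl) s≤d ≤-refl))
        (fits {r = r} start (inj₁ end≡d) (≡⇒≤ end≡d)) end≡d
      where
      ar : ∀ s t m A r C → t + 0 ≡ m → s ≡ t + 2 * A → A + r ≡ C → s + 2 * r ≡ 2 * C + m
      ar s t m A r C refl refl refl = solve (t ∷ A ∷ r ∷ [])
      end≡d : s + 2 * r ≡ d
      end≡d = trans (ar s t m (S s) r _ t≡ s≡ r≡) (sym d≡)
      pos : S s + 1 ≤ S (suc d) → 1 ≤ r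
      pos p = +-cancelˡ-≤ (S s) 1 r (≤-trans p (≡⇒≥ r≡))
    tiling-from (suc k) t s t≡ start s≤d s≡
      with p , s≤p , p<d , free , p≡ ← scan t s (≤-trans (s≤s (m≤m+n t k)) (≡⇒≤ (trans (sym (+-suc t k)) t≡)))
             (d ∸ s) s 0 (trans (cong (d ∸ s +_) (+-identityʳ s)) (m∸n+n≡m s≤d)) start ≤-refl (≡⇒≤ s≡) (λ _ ())
      with r , r≡ ← m≤n⇒∃[o]m+o≡n (sumTo-monoʳ ρ (m≤n⇒m≤1+n s≤p))
      with refl ← segment-arith s t (S s) r (S (suc p)) p s≡ r≡ p≡
      = cut r (+-cancelˡ-≤ (S s) 1 r (≤-trans (occupied-segment start (inj₂ free) s≤p (<⇒≤ p<d)) (≡⇒≥ r≡)))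
            (fits {r = r} start (inj₂ free) (<⇒≤ p<d)) p<d
            (tiling-from k (suc t) _ (trans (sym (+-suc t k)) t≡) (inj₂ (_ , refl , free)) p<d (cong suc p≡))

    abstract
      tiling : Tiling Fits d 0 m
      tiling = tiling-from m 0 0 refl (inj₁ refl) z≤n refl

-- Walks, distances and bridges

any-elim : ∀ {A : Set} (p : A → Bool) xs → any p xs ≡ true → ∃[ x ] x ∈ xs × p x ≡ true
any-elim p (x ∷ xs) eq with p x in px
... | true  = x , here refl , px
... | false with y , y∈ , py ← any-elim p xs eq = y , there y∈ , py

any-intro : ∀ {A : Set} (p : A → Bool) {xs x} → x ∈ xs → p x ≡ true → any p xs ≡ true
any-intro p {y ∷ xs} (here refl) px rewrite px = refl
any-intro p {y ∷ xs} (there x∈)  px rewrite any-intro p x∈ px = ∨-zeroʳ (p y)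

∧-elim : ∀ {a b} → a ∧ b ≡ true → a ≡ true × b ≡ true
∧-elim {true} {true} _ = refl , refl

⌊⌋-elim : ∀ {P : Set} (d : Dec P) → ⌊ d ⌋ ≡ true → P
⌊⌋-elim (yes p) _ = p

⌊⌋-intro : ∀ {P : Set} (d : Dec P) → P → ⌊ d ⌋ ≡ true
⌊⌋-intro (yes _) _ = refl
⌊⌋-intro (no ¬p) p = contradiction p ¬p

data Walk {N} (A : Adj N) : ℕ → Fin N → Fin N → Set where
  stop : ∀ {u} → Walk A 0 u u
  step : ∀ {k u w v} → A u w ≡ true → Walk A k w v → Walk A (suc k) u v

walk-++ : ∀ {N} {A : Adj N} {k l u v w} → Walk A k u v → Walk A l v w → Walk A (k + l) u w
walk-++ stop       q = q
walk-++ (step a p) q = step a (walk-++ p q)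

walk-reverse : ∀ {N} {A : Adj N} → (∀ u v → A u v ≡ true → A v u ≡ true) → ∀ {k u v} → Walk A k u v → Walk A k v u
walk-reverse sy stop = stop
walk-reverse {A = A} sy {suc k} {u} {v} (step a p) = subst (λ n → Walk A n v u) (+-comm k 1) (walk-++ (walk-reverse sy p) (step (sy _ _ a) stop))

walk-map : ∀ {N} {A B : Adj N} → (∀ u v → A u v ≡ true → B u v ≡ true) → ∀ {k u v} → Walk A k u v → Walk B k u v
walk-map f stop       = stop
walk-map f (step a p) = step (f _ _ a) (walk-map f p)

reach⇒walk : ∀ {N} (A : Adj N) k {u v} → reach A k u v ≡ true → ∃[ l ] l ≤ k × Walk A l u v
reach⇒walk A zero {u} {v} r with refl ← ⌊⌋-elim (u Finₚ.≟ v) r = 0 , z≤n , stop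
reach⇒walk {N} A (suc k) {u} {v} r with reach A k u v in eq
... | true with l , l≤k , p ← reach⇒walk A k eq = l , m≤n⇒m≤1+n l≤k , p
... | false with w , _ , e ← any-elim (λ w → A u w ∧ reach A k w v) (allFin N) r
            with a , r′ ← ∧-elim e
            with l , l≤k , p ← reach⇒walk A k r′ = suc l , s≤s l≤k , step a p

reach-suc : ∀ {N} (A : Adj N) k {u v} → reach A k u v ≡ true → reach A (suc k) u v ≡ true
reach-suc A k r rewrite r = refl

walk⇒reach : ∀ {N} {A : Adj N} {l u v} → Walk A l u v → ∀ {k} → l ≤ k → reach A k u v ≡ true
walk⇒reach {u = u} stop {zero}  _ = ⌊⌋-intro (u Finₚ.≟ u) refl
walk⇒reach {A = A} stop {suc k} _ = reach-suc A k (walk⇒reach {A = A} stop {k} z≤n)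
walk⇒reach {A = A} {u = u} {v = v} (step {w = w} a p) {suc k} (s≤s l≤k) =
  trans (cong (reach A k u v ∨_) (any-intro (λ w → A u w ∧ reach A k w v) (∈-allFin w) (trans (cong (_∧ reach A k w v) a) ((walk⇒reach p {k} l≤k)))))
        (∨-zeroʳ (reach A k u v))

data Path {N} (A : Adj N) : Fin N → List (Fin N) → Fin N → Set where
  stop : ∀ {u} → Path A u [] u
  step : ∀ {u w xs v} → A u w ≡ true → Path A w xs v → Path A u (w ∷ xs) v

path⇒walk : ∀ {N} {A : Adj N} {u xs v} → Path A u xs v → Walk A (length xs) u v
path⇒walk stop       = stop
path⇒walk (step a p) = step a (path⇒walk p)

path-suffix : ∀ {N} {A : Adj N} {w xs v u} → Path A w xs v → Unique (w ∷ xs) → u ∈ w ∷ xs →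
  ∃[ ys ] length ys ≤ length xs × Path A u ys v × Unique (u ∷ ys)
path-suffix p un (here refl) = _ , ≤-refl , p , un
path-suffix (step a p) (_ AllPairs.∷ un) (there u∈) with ys , l , q , un′ ← path-suffix p un u∈ = ys , m≤n⇒m≤1+n l , q , un′

simple-path : ∀ {N} {A : Adj N} {k u v} → Walk A k u v → ∃[ xs ] length xs ≤ k × Path A u xs v × Unique (u ∷ xs)
simple-path stop = [] , z≤n , stop , All.[] AllPairs.∷ AllPairs.[]
simple-path {u = u} (step {w = w} a p) with xs , l , q , un ← simple-path p with DecMembership._∈?_ Finₚ._≟_ u (w ∷ xs)
... | yes u∈ with ys , l′ , q′ , un′ ← path-suffix q un u∈ = ys , m≤n⇒m≤1+n (≤-trans l′ l) , q′ , un′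
... | no  u∉ = w ∷ xs , s≤s l , step a q , ¬Any⇒All¬ _ u∉ AllPairs.∷ un

lookup-injective : ∀ {A : Set} {xs : List A} → Unique xs → ∀ {i j} → lookup xs i ≡ lookup xs j → i ≡ j
lookup-injective (_ AllPairs.∷ _)  {zero}  {zero}  _  = refl
lookup-injective {xs = x ∷ xs} (d AllPairs.∷ _) {zero}  {suc j} eq = contradiction eq (All.lookup d (∈-lookup {xs = xs} j))
lookup-injective {xs = x ∷ xs} (d AllPairs.∷ _) {suc i} {zero}  eq = contradiction (sym eq) (All.lookup d (∈-lookup {xs = xs} i))
lookup-injective (_ AllPairs.∷ un) {suc i} {suc j} eq = cong suc (lookup-injective un eq)

-- The vertices of a simple path inject into `Fin N`; this is why the fuel `N` in `distA` and in
-- `sameComp` suffices.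
shorten : ∀ {N} {A : Adj N} {k u v} → Walk A k u v → ∃[ l ] l < N × Walk A l u v
shorten p with xs , _ , q , un ← simple-path p = length xs , injective⇒≤ (lookup-injective un) , path⇒walk q

search-≤ : ∀ (p : ℕ → Bool) k f {j} → k ≤ j → p j ≡ true → search p k f ≤ j
search-≤ p k zero    k≤j _ = k≤j
search-≤ p k (suc f) k≤j pj with p k in pk
... | true  = k≤j
... | false = search-≤ p (suc k) f (≤∧≢⇒< k≤j λ { refl → contradiction (trans (sym pk) pj) λ () }) pj

search-true : ∀ (p : ℕ → Bool) k f {j} → k ≤ j → j ≤ k + f → p j ≡ true → p (search p k f) ≡ true
search-true p k zero    k≤j j≤ pj = subst (λ i → p i ≡ true) (≤-antisym (≤-trans j≤ (≡⇒≤ (+-identityʳ k))) k≤j) pj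
search-true p k (suc f) k≤j j≤ pj with p k in pk
... | true  = pk
... | false = search-true p (suc k) f (≤∧≢⇒< k≤j λ { refl → contradiction (trans (sym pk) pj) λ () }) (≤-trans j≤ (≡⇒≤ (+-suc k f))) pj

distA-≤ : ∀ {N} {A : Adj N} {l u v} → Walk A l u v → distA A u v ≤ l
distA-≤ {N} {A} {l} {u} {v} p = search-≤ (λ k → reach A k u v) 0 N z≤n (walk⇒reach p ≤-refl)

distA-walk : ∀ {N} {A : Adj N} {l u v} → Walk A l u v → Walk A (distA A u v) u v
distA-walk {N} {A} {u = u} {v} p with l , l<N , q ← shorten p
  with k , k≤ , w ← reach⇒walk A (distA A u v) (search-true (λ k → reach A k u v) 0 N z≤n (<⇒≤ l<N) (walk⇒reach q ≤-refl)) =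
  subst (λ n → Walk A n u v) (≤-antisym k≤ (distA-≤ w)) w

module _ {N} (G : Graph N) where

  inEdges⇒∈ : ∀ M {u v} → inEdges G M u v ≡ true → (u , v) ∈ M
  inEdges⇒∈ M {u} {v} eq with (a , b) , e∈ , q ← any-elim _ M eq
    with q₁ , q₂ ← ∧-elim q with refl ← ⌊⌋-elim (a Finₚ.≟ u) q₁ | refl ← ⌊⌋-elim (b Finₚ.≟ v) q₂ = e∈

  ∈⇒inEdges : ∀ M {u v} → (u , v) ∈ M → inEdges G M u v ≡ true
  ∈⇒inEdges M {u} {v} e∈ = any-intro _ e∈ (cong₂ _∧_ (⌊⌋-intro (u Finₚ.≟ u) refl) (⌊⌋-intro (v Finₚ.≟ v) refl))

  adjMinus-intro : ∀ M {u v} → adj G u v ≡ true → (u , v) ∉ M → (v , u) ∉ M → adjMinus G M u v ≡ true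
  adjMinus-intro M {u} {v} a ∉₁ ∉₂ with inEdges G M u v in e₁
  ... | true = contradiction (inEdges⇒∈ M e₁) ∉₁
  ... | false with inEdges G M v u in e₂
  ...   | true  = contradiction (inEdges⇒∈ M e₂) ∉₂
  ...   | false = trans (cong (_∧ true) a) refl

  adjMinus-elim : ∀ M {u v} → adjMinus G M u v ≡ true → adj G u v ≡ true × (u , v) ∉ M × (v , u) ∉ M
  adjMinus-elim M {u} {v} eq with a , n ← ∧-elim eq = a , no₁ n , no₂ n
    where
    no₁ : not (inEdges G M u v ∨ inEdges G M v u) ≡ true → (u , v) ∉ M
    no₁ n e∈ = contradiction (trans (sym n) (cong (λ b → not (b ∨ inEdges G M v u)) (∈⇒inEdges M e∈))) λ ()
    no₂ : not (inEdges G M u v ∨ inEdges G M v u) ≡ true → (v , u) ∉ M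
    no₂ n e∈ = contradiction (trans (sym n) (trans (cong (λ b → not (inEdges G M u v ∨ b)) (∈⇒inEdges M e∈)) (cong not (∨-zeroʳ (inEdges G M u v))))) λ ()

  adj-sym : ∀ u v → adj G u v ≡ true → adj G v u ≡ true
  adj-sym u v a = trans (Graph.sym G v u) a

  adjMinus-sym : ∀ M u v → adjMinus G M u v ≡ true → adjMinus G M v u ≡ true
  adjMinus-sym M u v a with a′ , n₁ , n₂ ← adjMinus-elim M a = adjMinus-intro M (adj-sym u v a′) n₂ n₁

  path-linked : ∀ M {u xs v z} → Path (adjMinus G M) u xs v → adj G v z ≡ true → Linked G (u ∷ xs ++ [ z ])
  path-linked M stop a = a , tt
  path-linked M (step b stop) a = proj₁ (adjMinus-elim M b) , a , tt
  path-linked M (step b p@(step _ _)) a = proj₁ (adjMinus-elim M b) , path-linked M p a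

  -- A simple path from `a` to `b` avoiding the edge is closed up by the edge to a cycle. The two
  -- paths too short for this would be a loop and the deleted edge itself.
  bridge : ¬ HasCycle G → ∀ {a b k} → adj G a b ≡ true → ¬ Walk (adjMinus G [ (a , b) ]) k a b
  bridge acyclic {a} {b} ab w with simple-path w
  ... | [] , _ , stop , _ = contradiction (trans (sym ab) (irrefl G a)) λ ()
  ... | _ ∷ [] , _ , step e stop , _ = proj₁ (proj₂ (adjMinus-elim [ (a , b) ] e)) (here refl)
  ... | x ∷ y ∷ xs , _ , p , un = acyclic (a , x ∷ y ∷ xs , s≤s (s≤s z≤n) , un , path-linked [ (a , b) ] p (adj-sym a b ab))

-- Projections onto a diametrical path

-- Vertices at depths a, c below the spine vertices x, z are at distance at least |a − c| if x ≡ z,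
-- and at least a + |x − z| + c otherwise; Apart says that r is not less than this bound.
Apart : (a x c z r : ℕ) → Set
Apart a x c z r = (x ≡ z → a ≤ c + r × c ≤ a + r) × (x ≢ z → a + x + c ≤ r + z × a + z + c ≤ r + x)

apart-step : ∀ {a b x c z k} → a ≤ suc b → b ≤ suc a → Apart b x c z k → Apart a x c z (suc k)
apart-step {a} {b} {x} {c} {z} {k} p₁ p₂ (same , diff) =
  (λ e → let q₁ , q₂ = same e in ar₁ a b c k p₁ q₁ , ar₂ a b c k p₂ q₂) ,
  (λ n → let q₁ , q₂ = diff n in ar₃ a b c x z k p₁ q₁ , ar₃ a b c z x k p₁ q₂)
  where
  ar₁ : ∀ a b c k → a ≤ suc b → b ≤ c + k → a ≤ c + suc k
  ar₁ a b c k p q = lin 0 (p ⊕ q) (solve (a ∷ b ∷ c ∷ k ∷ []))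
  ar₂ : ∀ a b c k → b ≤ suc a → c ≤ b + k → c ≤ a + suc k
  ar₂ a b c k p q = lin 0 (p ⊕ q) (solve (a ∷ b ∷ c ∷ k ∷ []))
  ar₃ : ∀ a b c x y k → a ≤ suc b → b + x + c ≤ k + y → a + x + c ≤ suc k + y
  ar₃ a b c x y k p q = lin 0 (p ⊕ q) (solve (a ∷ b ∷ c ∷ x ∷ y ∷ k ∷ []))

-- An edge of the path joins two vertices of depth 0. The bound changes its form when the edge
-- enters the branch of the target (`y ≡ z`) or leaves it (`x ≡ z`), and these cases need separate
-- arithmetic.
apart-jump : ∀ {x y c z k} → x ≢ y → x ≤ suc y → y ≤ suc x → Apart 0 y c z k → Apart 0 x c z (suc k)
apart-jump {x} {y} {c} {z} {k} x≢y p₁ p₂ (same , diff) with y ≟ z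
... | yes refl = (λ e → contradiction e x≢y) , λ _ → ar x z c k p₁ c≤k , ar z x c k p₂ c≤k
  where
  c≤k = proj₂ (same refl)
  ar : ∀ x z c k → x ≤ suc z → c ≤ k → x + c ≤ suc k + z
  ar x z c k p q = lin 0 (p ⊕ q) (solve (x ∷ z ∷ c ∷ k ∷ []))
... | no y≢z with q₁ , q₂ ← diff y≢z =
  (λ { refl → z≤n , ar₁ x y c k p₂ q₂ }) , λ _ → ar₂ x y c z k p₁ q₁ , ar₃ x y c z k p₂ q₂
  where
  ar₁ : ∀ x y c k → y ≤ suc x → x + c ≤ k + y → c ≤ suc k
  ar₁ x y c k p q = lin 0 (p ⊕ q) (solve (x ∷ y ∷ c ∷ k ∷ []))
  ar₂ : ∀ x y c z k → x ≤ suc y → y + c ≤ k + z → x + c ≤ suc k + z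
  ar₂ x y c z k p q = lin 0 (p ⊕ q) (solve (x ∷ y ∷ c ∷ z ∷ k ∷ []))
  ar₃ : ∀ x y c z k → y ≤ suc x → z + c ≤ k + y → z + c ≤ suc k + x
  ar₃ x y c z k p q = lin 0 (p ⊕ q) (solve (x ∷ y ∷ c ∷ z ∷ k ∷ []))

apart-mono : ∀ {a x c z r r′} → r ≤ r′ → Apart a x c z r → Apart a x c z r′
apart-mono r≤ (same , diff) =
  (λ e → ≤-trans (proj₁ (same e)) (+-monoʳ-≤ _ r≤) , ≤-trans (proj₂ (same e)) (+-monoʳ-≤ _ r≤)) ,
  (λ n → ≤-trans (proj₁ (diff n)) (+-monoˡ-≤ _ r≤) , ≤-trans (proj₂ (diff n)) (+-monoˡ-≤ _ r≤))

-- Here and in `apart-end₁` diametrality enters: no vertex is further than `d` from an end of the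
-- path, so a branch is at most as deep as its foot is far from the other end.
apart-end₀ : ∀ {a x d} → Apart a x 0 d d → a ≤ x
apart-end₀ {a} {x} {d} (same , diff) with x ≟ d
... | yes refl = proj₁ (same refl)
... | no  x≢d  = +-cancelʳ-≤ d a x (≤-trans (m≤m+n (a + d) 0) (≤-trans (proj₂ (diff x≢d)) (≡⇒≤ (+-comm d x))))

apart-end₁ : ∀ {a x d} → Apart a x 0 0 d → a + x ≤ d
apart-end₁ {a} {x} {d} (same , diff) with x ≟ 0
... | yes refl = ≤-trans (≡⇒≤ (+-identityʳ a)) (proj₁ (same refl))
... | no  x≢0  = ≤-trans (m≤m+n (a + x) 0) (≤-trans (proj₁ (diff x≢0)) (≡⇒≤ (+-identityʳ d)))

largest : ∀ {P : ℕ → Set} → (∀ k → Dec (P k)) → P 0 → ∀ n → ∃[ k ] k ≤ n × P k × (∀ l → k < l → l ≤ n → ¬ P l)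
largest P? p₀ zero = 0 , z≤n , p₀ , λ l 0<l l≤0 → contradiction l≤0 (<⇒≱ 0<l)
largest {P} P? p₀ (suc n) with P? (suc n)
... | yes p = suc n , ≤-refl , p , λ l n<l l≤n → contradiction l≤n (<⇒≱ n<l)
... | no ¬p with k , k≤n , pk , above ← largest P? p₀ n = k , m≤n⇒m≤1+n k≤n , pk , beyond
  where
  beyond : ∀ l → k < l → l ≤ suc n → ¬ P l
  beyond l k<l l≤ with m≤n⇒m<n∨m≡n l≤
  ... | inj₁ l<  = above l k<l (≤-pred l<)
  ... | inj₂ refl = ¬p

spike-same : ∀ {a c i} → i ≡ a → spike a c i ≡ c
spike-same {a} {c} refl = spike-at a c

-- The load of a dominating broadcast on the path

-- A dominating f on a tree, seen from the spine: e j is how far the vertices of branch j reach along the spine,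
-- x j is the part of their total strength not used for that, and h j is the depth of branch j.
module Load {N} (d : ℕ) (π t : Fin N → ℕ)
  (π≤d : ∀ u → π u ≤ d) (t≤π : ∀ u → t u ≤ π u) (t+π≤d : ∀ u → t u + π u ≤ d)
  (p : ℕ → Fin N) (π-p : ∀ {i} → i ≤ d → π (p i) ≡ i) (t-p : ∀ {i} → i ≤ d → t (p i) ≡ 0)
  (depth-level : ∀ u k → k ≤ t u → ∃[ w ] π w ≡ π u × t w ≡ k)
  (f : Fin N → ℕ)
  (heard : ∀ u → ∃[ v ] 0 < f v × Apart (t u) (π u) (t v) (π v) (f v))
  where

  -- The maximum runs over all vertices, those of other branches counting 0. The maximiser may thus
  -- lie in another branch, but only if the maximum is 0, which explains the alternatives in `tip`
  -- and `reacher`.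
  branchMax : (Fin N → ℕ) → ℕ → Fin N
  branchMax g j = proj₁ (argmax (p 0) (λ v → spike (π v) (g v) j))

  ρ : ℕ → ℕ
  ρ j = sumF (λ v → spike (π v) (f v) j)

  abstract
    e x h : ℕ → ℕ
    e j = spike (π (branchMax (λ v → f v ∸ t v) j)) (f (branchMax (λ v → f v ∸ t v) j) ∸ t (branchMax (λ v → f v ∸ t v) j)) j
    x j = ρ j ∸ e j
    h j = spike (π (branchMax t j)) (t (branchMax t j)) j

    f∸t≤e : ∀ v → f v ∸ t v ≤ e (π v)
    f∸t≤e v = ≤-trans (≡⇒≥ (spike-at (π v) (f v ∸ t v))) (proj₂ (argmax (p 0) (λ w → spike (π w) (f w ∸ t w) (π v))) v)

    t≤h : ∀ v → t v ≤ h (π v)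
    t≤h v = ≤-trans (≡⇒≥ (spike-at (π v) (t v))) (proj₂ (argmax (p 0) (λ w → spike (π w) (t w) (π v))) v)

    f≤ρ : ∀ v → f v ≤ ρ (π v)
    f≤ρ v = ≤-trans (≡⇒≥ (spike-at (π v) (f v))) (sumF-term (λ w → spike (π w) (f w) (π v)) v)

    tip : ∀ j → h j ≡ 0 ⊎ ∃[ u ] π u ≡ j × t u ≡ h j
    tip j with j ≟ π (branchMax t j)
    ... | yes j≡ = inj₂ (branchMax t j , sym j≡ , sym (+-identityʳ _))
    ... | no  _  = inj₁ refl

    reacher : ∀ j → e j ≡ 0 ⊎ ∃[ u ] π u ≡ j × f u ∸ t u ≡ e j
    reacher j with j ≟ π (branchMax (λ v → f v ∸ t v) j)
    ... | yes j≡ = inj₂ (branchMax (λ v → f v ∸ t v) j , sym j≡ , sym (+-identityʳ _))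
    ... | no  _  = inj₁ refl

    h≤ : ∀ j → j ≤ d → h j ≤ j
    h≤ j j≤d with tip j
    ... | inj₁ h≡0 = ≤-trans (≡⇒≤ h≡0) z≤n
    ... | inj₂ (u , refl , t≡) = ≤-trans (≡⇒≥ t≡) (t≤π u)

    h+≤ : ∀ j → j ≤ d → h j + j ≤ d
    h+≤ j j≤d with tip j
    ... | inj₁ h≡0 = ≤-trans (+-monoˡ-≤ j (≡⇒≤ h≡0)) j≤d
    ... | inj₂ (u , refl , t≡) = ≤-trans (+-monoˡ-≤ j (≡⇒≥ t≡)) (t+π≤d u)

    e≤ρ : ∀ j → e j ≤ ρ j
    e≤ρ j with reacher j
    ... | inj₁ e≡0 = ≤-trans (≡⇒≤ e≡0) z≤n
    ... | inj₂ (u , refl , f≡) = ≤-trans (≡⇒≥ f≡) (≤-trans (m∸n≤m (f u) (t u)) (f≤ρ u))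

    e+x≡ρ : ∀ j → e j + x j ≡ ρ j
    e+x≡ρ j = m+[n∸m]≡n (e≤ρ j)

    total : sumTo (λ j → e j + x j) (suc d) ≡ sumF f
    total = trans (sumTo-cong (suc d) (λ j _ → e+x≡ρ j))
      (trans (sumTo-sumF-swap (λ j v → spike (π v) (f v) j) (suc d))
             (sumF-cong (λ v → sumTo-spike (π v) (f v) (s≤s (π≤d v)))))

  -- In other words k + |i - j| ≤ e i for some i: the reach of K_i, continued into branch j, gets to
  -- depth `k`. The choice i = j is allowed.
  Reached : ℕ → ℕ → Set
  Reached j k = ∃[ i ] i < suc d × k + i ≤ e i + j × k + j ≤ e i + i

  reached? : ∀ j k → Dec (Reached j k)
  reached? j k = anyUpTo? (λ i → (k + i ≤? e i + j) ×-dec (k + j ≤? e i + i)) (suc d)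

  reached-at : ∀ {j k} v → k + j + t v ≤ f v + π v → k + π v + t v ≤ f v + j → k + π v ≤ e (π v) + j × k + j ≤ e (π v) + π v
  reached-at {j} {k} v p₁ p₂ = ar k (π v) (t v) (f v) _ j f≤ p₂ , ar k j (t v) (f v) _ (π v) f≤ p₁
    where
    f≤ : f v ≤ e (π v) + t v
    f≤ = ≤-trans (m≤n+m∸n (f v) (t v)) (≤-trans (≡⇒≤ (+-comm (t v) _)) (+-monoˡ-≤ (t v) (f∸t≤e v)))
    ar : ∀ k i t f e j → f ≤ e + t → k + i + t ≤ f + j → k + i ≤ e + j
    ar k i t f e j p q = lin 0 (p ⊕ q) (solve (k ∷ i ∷ t ∷ f ∷ e ∷ j ∷ []))

  reached-by : ∀ {j k} v → k + j + t v ≤ f v + π v → k + π v + t v ≤ f v + j → Reached j k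
  reached-by v p₁ p₂ = π v , s≤s (π≤d v) , reached-at v p₁ p₂

  -- The points at depth k > E of branch j that are not reached from the spine are heard within the branch.
  -- A vertex v of the branch serves at most 2 f v + 1 ≤ 3 f v of them, and the vertex reaching e j along
  -- the spine at most 2 (f v − e j) of them.
  module Unreached (j E m : ℕ) (E+m≡h : E + m ≡ h j) (unreached : ∀ k → E < k → k ≤ h j → ¬ Reached j k) (j≤d : j ≤ d) where

    -- The index `k′` stands for the depth `suc (E + k′)`. The last condition says that this depth
    -- exceeds `e j`, which is what saves one count per unit of `e j` in `count-reacher`.
    Serves : Fin N → ℕ → Set
    Serves v k′ = j ≡ π v × 0 < f v × suc (E + k′) ≤ t v + f v × t v ≤ suc (E + k′) + f v × e j ≤ E + k′

    serves? : ∀ v k′ → Dec (Serves v k′)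
    serves? v k′ = (j ≟ π v) ×-dec (0 <? f v) ×-dec (suc (E + k′) ≤? t v + f v) ×-dec (t v ≤? suc (E + k′) + f v) ×-dec (e j ≤? E + k′)

    served : ∀ k′ → k′ < m → ∃[ v ] Serves v k′
    served k′ k′<m = from-tip (tip j)
      where
      k = suc (E + k′)
      k≤h : k ≤ h j
      k≤h = ≤-trans (≡⇒≤ (sym (+-suc E k′))) (≤-trans (+-monoʳ-≤ E k′<m) (≡⇒≤ E+m≡h))
      not-reached : ¬ Reached j k
      not-reached = unreached k (s≤s (m≤m+n E k′)) k≤h
      hearing : ∀ y v → π y ≡ j → t y ≡ k → 0 < f v → Apart (t y) (π y) (t v) (π v) (f v) → ∃[ v ] Serves v k′
      hearing y v πy ty 0<f (same , diff) with π y ≟ π v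
      ... | no ne = contradiction (reached-by v (subst₂ (λ a b → a + b + t v ≤ f v + π v) ty πy (proj₁ (diff ne)))
                                                (subst₂ (λ a b → a + π v + t v ≤ f v + b) ty πy (proj₂ (diff ne)))) not-reached
      ... | yes eq = v , trans (sym πy) eq , 0<f , subst (_≤ t v + f v) ty (proj₁ (same eq)) ,
                     subst (λ a → t v ≤ a + f v) ty (proj₂ (same eq)) ,
                     ≤-pred (≰⇒> λ k≤e → not-reached (j , s≤s j≤d , +-monoˡ-≤ j k≤e , +-monoˡ-≤ j k≤e))
      from-tip : h j ≡ 0 ⊎ ∃[ u ] π u ≡ j × t u ≡ h j → ∃[ v ] Serves v k′
      from-tip (inj₁ h≡0) = contradiction (≤-trans k≤h (≡⇒≤ h≡0)) λ ()
      from-tip (inj₂ (u , πu , t≡)) =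
        let y , πy , ty = depth-level u k (≤-trans k≤h (≡⇒≥ t≡))
            v , 0<f , apart = heard y
        in hearing y v (trans πy πu) ty 0<f apart

    count : Fin N → ℕ
    count v = sumTo (λ k′ → ind (serves? v k′)) m

    count-any : ∀ v → count v ≤ 3 * spike (π v) (f v) j
    count-any v = cases (j ≟ π v) (0 <? f v)
      where
      lo : ℕ
      lo = (t v ∸ f v) ∸ suc E
      t≤ : t v ≤ lo + suc E + f v
      t≤ = ≤-trans (m≤n+m∸n (t v) (f v)) (≤-trans (≡⇒≤ (+-comm (f v) _)) (+-monoˡ-≤ (f v)
        (≤-trans (m≤n+m∸n (t v ∸ f v) (suc E)) (≡⇒≤ (+-comm (suc E) lo)))))
      ar₁ : ∀ E k t f lo → t ≤ lo + suc E + f → suc (E + k) ≤ t + f → suc k ≤ lo + suc (f + f)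
      ar₁ E k t f lo p q = lin 0 (p ⊕ q) (solve (E ∷ k ∷ t ∷ f ∷ lo ∷ []))
      ar₂ : ∀ f → 0 < f → suc (f + f) ≤ 3 * f
      ar₂ f p = lin 0 p (solve (f ∷ []))
      inside : ∀ k′ → Serves v k′ → lo ≤ k′ × k′ < lo + suc (f v + f v)
      inside k′ (_ , _ , ≤₁ , ≤₂ , _) =
        m≤n+o⇒m∸n≤o (t v ∸ f v) (suc E) (m≤n+o⇒m∸n≤o (t v) (f v) (≤-trans ≤₂ (≡⇒≤ (+-comm _ (f v))))) ,
        ar₁ E k′ (t v) (f v) lo t≤ ≤₁
      cases : Dec (j ≡ π v) → Dec (0 < f v) → count v ≤ 3 * spike (π v) (f v) j
      cases (no j≢) _ = ≤-trans (≡⇒≤ (sumTo-zero m λ k′ _ → ind-no (serves? v k′) (j≢ ∘ proj₁))) z≤n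
      cases (yes _) (no ¬0<f) = ≤-trans (≡⇒≤ (sumTo-zero m λ k′ _ → ind-no (serves? v k′) (¬0<f ∘ proj₁ ∘ proj₂))) z≤n
      cases (yes j≡) (yes 0<f) = ≤-trans (count-interval (serves? v) lo (suc (f v + f v)) inside m)
        (≤-trans (ar₂ (f v) 0<f) (≡⇒≥ (cong (3 *_) (spike-same {π v} {f v} j≡))))

    -- Only depths above `e j` and up to t + f = 2 t + e remain, at most 2 t of them, and 2 t + 3 e
    -- ≤ 3 (t + e). Keeping `3 * e j` aside here is what lets the final bound be in terms of `x j`
    -- and not of `ρ j`.
    count-reacher : ∀ v → j ≡ π v → f v ∸ t v ≡ e j → 1 ≤ e j → count v + 3 * e j ≤ 3 * spike (π v) (f v) j
    count-reacher v j≡ f≡ 1≤e = ≤-trans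
      (ar₂ (t v) (e j) (f v) (count v) f≡t+e (count-interval (serves? v) (e j ∸ E) (t v + t v) inside m))
      (≡⇒≥ (cong (3 *_) (spike-same {π v} {f v} j≡)))
      where
      f≡t+e : f v ≡ t v + e j
      f≡t+e = trans (sym (m+[n∸m]≡n {t v} (<⇒≤ (m∸n≢0⇒n<m {f v} (λ z → <-irrefl (trans (sym z) f≡) 1≤e))))) (cong (t v +_) f≡)
      ar₁ : ∀ E k t f e lo → f ≡ t + e → e ≤ E + lo → suc (E + k) ≤ t + f → suc k ≤ lo + (t + t)
      ar₁ E k t f e lo refl p q = lin 0 (p ⊕ q) (solve (E ∷ k ∷ t ∷ e ∷ lo ∷ []))
      ar₂ : ∀ t e f c → f ≡ t + e → c ≤ t + t → c + 3 * e ≤ 3 * f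
      ar₂ t e f c refl p = lin t p (solve (t ∷ e ∷ c ∷ []))
      inside : ∀ k′ → Serves v k′ → e j ∸ E ≤ k′ × k′ < (e j ∸ E) + (t v + t v)
      inside k′ (_ , _ , ≤₁ , _ , ≤₃) = m≤n+o⇒m∸n≤o (e j) E ≤₃ , ar₁ E k′ (t v) (f v) (e j) _ f≡t+e (m≤n+m∸n (e j) E) ≤₁

    m≤counts : m ≤ sumF count
    m≤counts = begin
      m                                                       ≡⟨ *-identityʳ m ⟨
      m * 1                                                   ≡⟨ sumTo-const 1 m ⟨
      sumTo (λ _ → 1) m                                       ≤⟨ sumTo-mono m one ⟩
      sumTo (λ k′ → sumF (λ v → ind (serves? v k′))) m        ≡⟨ sumTo-sumF-swap (λ k′ v → ind (serves? v k′)) m ⟩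
      sumF count                                              ∎
      where
      open ≤-Reasoning
      one : ∀ k′ → k′ < m → 1 ≤ sumF (λ v → ind (serves? v k′))
      one k′ k′<m with v , s ← served k′ k′<m = ≤-trans (ind-yes (serves? v k′) s) (sumF-term (λ v → ind (serves? v k′)) v)

    with-bonus : ∀ B → (∀ v → count v + B v ≤ 3 * spike (π v) (f v) j) → m + sumF B ≤ 3 * ρ j
    with-bonus B per-vertex = begin
      m + sumF B                                ≤⟨ +-monoˡ-≤ (sumF B) m≤counts ⟩
      sumF count + sumF B                       ≡⟨ sumF-add count B ⟨
      sumF (λ v → count v + B v)                ≤⟨ sumF-mono per-vertex ⟩
      sumF (λ v → 3 * spike (π v) (f v) j)      ≡⟨ sumF-scale 3 (λ v → spike (π v) (f v) j) ⟩
      3 * ρ j                                   ∎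
      where open ≤-Reasoning

    m+3e≤3ρ : m + 3 * e j ≤ 3 * ρ j
    m+3e≤3ρ = cases (reacher j) (1 ≤? e j)
      where
      none : e j ≡ 0 → m + 3 * e j ≤ 3 * ρ j
      none e≡0 = ≤-trans (+-monoʳ-≤ m (≤-trans (≡⇒≤ (cong (3 *_) e≡0)) z≤n))
        (with-bonus (λ _ → 0) λ v → ≤-trans (≡⇒≤ (+-identityʳ (count v))) (count-any v))
      cases : e j ≡ 0 ⊎ ∃[ u ] π u ≡ j × f u ∸ t u ≡ e j → Dec (1 ≤ e j) → m + 3 * e j ≤ 3 * ρ j
      cases (inj₁ e≡0) _ = none e≡0
      cases (inj₂ _) (no ¬1≤e) = none (n≤0⇒n≡0 (≤-pred (≰⇒> ¬1≤e)))
      cases (inj₂ (u , πu , f≡)) (yes 1≤e) =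
        subst (λ z → m + z ≤ 3 * ρ j) (trans (sumF-single B u B-off) B-at) (with-bonus B per-vertex)
        where
        B : Fin N → ℕ
        B v = ind (v Finₚ.≟ u) * (3 * e j)
        B-off : ∀ v → v ≢ u → B v ≡ 0
        B-off v v≢u = cong (_* (3 * e j)) (ind-no (v Finₚ.≟ u) v≢u)
        B-at : B u ≡ 3 * e j
        B-at = trans (cong (_* (3 * e j)) (≤-antisym (ind≤1 (u Finₚ.≟ u)) (ind-yes (u Finₚ.≟ u) refl))) (+-identityʳ _)
        per-vertex : ∀ v → count v + B v ≤ 3 * spike (π v) (f v) j
        per-vertex v = by (v Finₚ.≟ u)
          where
          by : Dec (v ≡ u) → count v + B v ≤ 3 * spike (π v) (f v) j
          by (no v≢u)   = ≤-trans (≡⇒≤ (trans (cong (count v +_) (B-off v v≢u)) (+-identityʳ (count v)))) (count-any v)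
          by (yes refl) = ≤-trans (≡⇒≤ (cong (count v +_) B-at)) (count-reacher v (sym πu) f≡ 1≤e)

    unreached-≤ : m ≤ 3 * x j
    unreached-≤ = +-cancelʳ-≤ (3 * e j) m (3 * x j) (≤-trans m+3e≤3ρ
      (≡⇒≤ (trans (cong (3 *_) (trans (sym (e+x≡ρ j)) (+-comm (e j) (x j)))) (*-distribˡ-+ 3 (x j) (e j)))))

  abstract
    reach-h : ∀ j → j ≤ d → ∃[ i ] i ≤ d × i ≤ j + e i × j ≤ i + e i × h j + j ≤ 3 * x j + (e i + i) × h j + i ≤ 3 * x j + (e i + j)
    -- `E` is the deepest reached level, and exists since depth 0 is reached from `j` itself. The
    -- `m` levels below it are paid for by `3 * x j`.
    reach-h j j≤d
      with E , E≤h , (i , i<sd , r₁ , r₂) , unreached ← largest (reached? j) (j , s≤s j≤d , m≤n+m j (e j) , m≤n+m j (e j)) (h j)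
      with m , E+m≡h ← m≤n⇒∃[o]m+o≡n E≤h =
      i , ≤-pred i<sd , ar₁ E i (e i) j r₁ , ar₁ E j (e i) i r₂ ,
      ar₂ E m (h j) (x j) (e i) i j E+m≡h m≤ r₂ , ar₂ E m (h j) (x j) (e i) j i E+m≡h m≤ r₁
      where
      m≤ : m ≤ 3 * x j
      m≤ = Unreached.unreached-≤ j E m E+m≡h unreached j≤d
      ar₁ : ∀ E i e j → E + i ≤ e + j → i ≤ j + e
      ar₁ E i e j p = lin E p (solve (E ∷ i ∷ e ∷ j ∷ []))
      ar₂ : ∀ E m h x e i j → E + m ≡ h → m ≤ 3 * x → E + j ≤ e + i → h + j ≤ 3 * x + (e + i)
      ar₂ E m h x e i j refl p q = lin 0 (p ⊕ q) (solve (E ∷ m ∷ x ∷ e ∷ i ∷ j ∷ []))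

    -- The vertex `p j` is heard. If this is from its own branch while `e j` is 0, the whole
    -- strength there went into `x j`; if from another branch, the interval centred there contains a
    -- point other than its centre, so its radius is positive.
    occupied : ∀ j → j ≤ d → 1 ≤ x j ⊎ ∃[ i ] i ≤ d × i ≤ j + e i × j ≤ i + e i × 1 ≤ e i
    occupied j j≤d with 1 ≤? e j
    ... | yes 1≤e = inj₂ (j , j≤d , m≤m+n j (e j) , m≤m+n j (e j) , 1≤e)
    ... | no ¬1≤e with v , 0<f , apart ← heard (p j) = hearing v 0<f (subst₂ (λ a b → Apart a b (t v) (π v) (f v)) (t-p j≤d) (π-p j≤d) apart)
      where
      e≡0 : e j ≡ 0
      e≡0 = n≤0⇒n≡0 (≤-pred (≰⇒> ¬1≤e))
      hearing : ∀ v → 0 < f v → Apart 0 j (t v) (π v) (f v) → 1 ≤ x j ⊎ ∃[ i ] i ≤ d × i ≤ j + e i × j ≤ i + e i × 1 ≤ e i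
      hearing v 0<f (same , diff) with j ≟ π v
      ... | yes refl = inj₁ (≤-trans 0<f (≤-trans (f≤ρ v) (≡⇒≥ (trans (cong (_+ x (π v)) (sym e≡0)) (e+x≡ρ (π v))))))
      ... | no ne with r₁ , r₂ ← reached-at {j} {0} v (proj₁ (diff ne)) (proj₂ (diff ne)) =
        inj₂ (π v , π≤d v , ≤-trans r₁ (≡⇒≤ (+-comm _ j)) , ≤-trans r₂ (≡⇒≤ (+-comm _ (π v))) ,
          n≢0⇒n>0 λ e≡0 → ne (≤-antisym (≤-trans r₂ (≡⇒≤ (cong (_+ π v) e≡0))) (≤-trans r₁ (≡⇒≤ (cong (_+ j) e≡0)))))

-- Maxima, lists and the number of increments

foldr-⊔-upper : ∀ {x xs} → x ∈ xs → x ≤ foldr _⊔_ 0 xs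
foldr-⊔-upper {xs = y ∷ ys} (here refl) = m≤m⊔n y _
foldr-⊔-upper {xs = y ∷ ys} (there x∈)  = ≤-trans (foldr-⊔-upper x∈) (m≤n⊔m y _)

foldr-⊔-least : ∀ {b xs} → (∀ {x} → x ∈ xs → x ≤ b) → foldr _⊔_ 0 xs ≤ b
foldr-⊔-least {xs = []}     h = z≤n
foldr-⊔-least {xs = x ∷ xs} h = ⊔-lub (h (here refl)) (foldr-⊔-least (h ∘ there))

length-filterᵇ : ∀ {A : Set} (b : A → Bool) f n → length (filterᵇ b (applyUpTo f n)) ≡ sumTo (λ i → if b (f i) then 1 else 0) n
length-filterᵇ b f zero    = refl
length-filterᵇ b f (suc n) = trans head-case (sym (sumTo-split (λ i → if b (f i) then 1 else 0) 1 n))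
  where
  head-case : length (filterᵇ b (applyUpTo f (suc n))) ≡ (if b (f 0) then 1 else 0) + sumTo (λ i → if b (f (suc i)) then 1 else 0) n
  head-case with b (f 0)
  ... | true  = cong suc (length-filterᵇ b (f ∘ suc) n)
  ... | false = length-filterᵇ b (f ∘ suc) n

edgeOf-applyUpTo : ∀ {N} (G : Graph N) (p : ℕ → Fin N) {d g} → g < d → EdgeOf G (applyUpTo p (suc d)) (p g , p (suc g))
edgeOf-applyUpTo G p {suc d} {zero}  _         = inj₁ (refl , refl)
edgeOf-applyUpTo G p {suc d} {suc g} (s≤s g<d) = inj₂ (edgeOf-applyUpTo G (p ∘ suc) g<d)

fin-one : ∀ {N} → N ≡ 1 → (a b : Fin N) → a ≡ b
fin-one refl zero zero = refl

two-≤ : ∀ {N} {a b : Fin N} → a ≢ b → 2 ≤ N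
two-≤ {suc zero}    {zero} {zero} a≢b = contradiction refl a≢b
two-≤ {suc (suc N)} _ = s≤s (s≤s z≤n)

ind-one : ∀ {a} {P : Set a} (d : Dec P) → P → ind d ≡ 1
ind-one d p = ≤-antisym (ind≤1 d) (ind-yes d p)

-- This is ⌈(k + 1) / 3⌉, the independent domination number of a path on k + 1 vertices, here the
-- segments left by `k` cuts. The recursion by three follows that of `plan`.
increments : ℕ → ℕ
increments (suc (suc (suc k))) = suc (increments k)
increments _                   = 1

increments*3≤ : ∀ k → increments k * 3 ≤ k + 1 + 2
increments*3≤ 0                   = ≤-refl
increments*3≤ 1                   = n≤1+n 3
increments*3≤ 2                   = m≤n⇒m≤1+n (n≤1+n 3)
increments*3≤ (suc (suc (suc k))) = +-monoʳ-≤ 3 (increments*3≤ k)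

increments-≤ : ∀ {k m} → k ≤ m → increments k ≤ ⌈ m + 1 /3⌉
increments-≤ {k} {m} k≤m = ≤-trans (≡⇒≥ (m*n/n≡m (increments k) 3))
  (/-monoˡ-≤ 3 (≤-trans (increments*3≤ k) (+-monoˡ-≤ 2 (+-monoˡ-≤ 1 k≤m))))

tiling-map : ∀ {F F′ : ℕ → ℕ → Set} {d} → (∀ {s r} → s + 2 * r ≤ d → F s r → F′ s r) → ∀ {s k} → Tiling F d s k → Tiling F′ d s k
tiling-map g (last r 1≤r ft q≡d)  = last r 1≤r (g (≡⇒≤ q≡d) ft) q≡d
tiling-map g (cut r 1≤r ft q<d T) = cut r 1≤r (g (<⇒≤ q<d) ft) q<d (tiling-map g T)

-- Branches of a tree along a diametrical path

-- Projection of a tree onto a diametrical path p 0 , … , p d: the vertex u hangs at depth t u below p (π u).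
module Spine {N} (G : Graph N) (connected : Connected G) (acyclic : ¬ HasCycle G)
  (d : ℕ) (p : ℕ → Fin N)
  (p-adj : ∀ i → i < d → adj G (p i) (p (suc i)) ≡ true)
  (p-injective : ∀ {i j} → i ≤ d → j ≤ d → p i ≡ p j → i ≡ j)
  (dist≤d : ∀ u v → dist G u v ≤ d)
  where

  edge : ℕ → Edge G
  edge g = p g , p (suc g)

  spineEdges : List (Edge G)
  spineEdges = applyUpTo edge d

  OnSpine : List (Edge G) → Set
  OnSpine M = ∀ {e} → e ∈ M → ∃[ g ] g < d × e ≡ edge g

  -- The components of this forest are the branches; by `same-foot` each contains at most one vertex
  -- of the path, and by `project` at least one.
  A₀ : Adj N
  A₀ = adjMinus G spineEdges

  A₀-sym : ∀ u v → A₀ u v ≡ true → A₀ v u ≡ true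
  A₀-sym = adjMinus-sym G spineEdges

  A₀⊆ : ∀ M → OnSpine M → ∀ u v → A₀ u v ≡ true → adjMinus G M u v ≡ true
  A₀⊆ M on u v a with a′ , n₁ , n₂ ← adjMinus-elim G spineEdges a = adjMinus-intro G M a′ (avoid n₁) (avoid n₂)
    where
    avoid : ∀ {e} → e ∉ spineEdges → e ∉ M
    avoid n e∈ with g , g<d , refl ← on e∈ = n (∈-applyUpTo⁺ edge g<d)

  spine-step : ∀ M → OnSpine M → ∀ g → g < d → edge g ∉ M → adjMinus G M (p g) (p (suc g)) ≡ true
  spine-step M on g g<d n = adjMinus-intro G M (p-adj g g<d) n backward
    where
    backward : (p (suc g) , p g) ∉ M
    backward e∈ with k , k<d , eq ← on e∈ =
      <-irrefl (trans (p-injective (<⇒≤ g<d) k<d (cong proj₂ eq)) (cong suc (sym (p-injective g<d (<⇒≤ k<d) (cong proj₁ eq))))) (m≤n⇒m≤1+n ≤-refl)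

  spine-walk : ∀ M → OnSpine M → ∀ i k → i + k ≤ d → (∀ g → i ≤ g → g < i + k → edge g ∉ M) → Walk (adjMinus G M) k (p i) (p (i + k))
  spine-walk M on i zero    _   _ = subst (λ j → Walk (adjMinus G M) 0 (p i) (p j)) (sym (+-identityʳ i)) stop
  spine-walk M on i (suc k) i+k≤ n rewrite +-suc i k =
    step (spine-step M on i (≤-trans (s≤s (m≤m+n i k)) i+k≤) (n i ≤-refl (s≤s (m≤m+n i k))))
         (spine-walk M on (suc i) k i+k≤ (λ g i<g → n g (<⇒≤ i<g)))

  -- Returning along the path from `p j` to `p (suc i)` would bypass the edge between `p i` and
  -- `p (suc i)`, which is a bridge.
  separated : ∀ {i j k} → i < j → j ≤ d → ¬ Walk A₀ k (p i) (p j)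
  separated {i} {j} i<j j≤d w with m , refl ← m≤n⇒∃[o]m+o≡n i<j =
    bridge G acyclic (p-adj i i<d)
      (walk-++ (walk-map (A₀⊆ M on) w) (walk-reverse (adjMinus-sym G M) (spine-walk M on (suc i) m j≤d avoid)))
    where
    M = [ edge i ]
    i<d : i < d
    i<d = ≤-trans i<j j≤d
    on : OnSpine M
    on (here refl) = i , i<d , refl
    avoid : ∀ g → suc i ≤ g → g < suc i + m → edge g ∉ M
    avoid g i<g g< (here eq) = <-irrefl (sym (p-injective (<⇒≤ (≤-trans g< j≤d)) (<⇒≤ i<d) (cong proj₁ eq))) i<g

  same-foot : ∀ {i j k} → i ≤ d → j ≤ d → Walk A₀ k (p i) (p j) → i ≡ j
  same-foot {i} {j} i≤d j≤d w with <-cmp i j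
  ... | tri< i<j _ _ = contradiction w (separated i<j j≤d)
  ... | tri≈ _ i≡j _ = i≡j
  ... | tri> _ _ j<i = contradiction (walk-reverse A₀-sym w) (separated j<i i≤d)

  adj-cases : ∀ {u v} → adj G u v ≡ true →
    A₀ u v ≡ true ⊎ (∃[ g ] g < d × u ≡ p g × v ≡ p (suc g)) ⊎ (∃[ g ] g < d × v ≡ p g × u ≡ p (suc g))
  adj-cases {u} {v} a with inEdges G spineEdges u v in e₁
  ... | true with g , g<d , refl ← ∈-applyUpTo⁻ edge (inEdges⇒∈ G spineEdges e₁) = inj₂ (inj₁ (g , g<d , refl , refl))
  ... | false with inEdges G spineEdges v u in e₂
  ...   | true with g , g<d , refl ← ∈-applyUpTo⁻ edge (inEdges⇒∈ G spineEdges e₂) = inj₂ (inj₂ (g , g<d , refl , refl))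
  ...   | false = inj₁ (trans (cong (_∧ true) a) refl)

  foot : ∀ {k u} → Walk (adj G) k u (p 0) → ∃[ j ] j ≤ d × ∃[ l ] Walk A₀ l u (p j)
  foot stop = 0 , z≤n , 0 , stop
  foot (step a w) with adj-cases a
  ... | inj₁ a₀ with j , j≤d , l , w′ ← foot w = j , j≤d , suc l , step a₀ w′
  ... | inj₂ (inj₁ (g , g<d , refl , _)) = g , <⇒≤ g<d , 0 , stop
  ... | inj₂ (inj₂ (g , g<d , _ , refl)) = suc g , g<d , 0 , stop

  walk-between : ∀ u v → ∃[ k ] Walk (adj G) k u v
  walk-between u v with k , r ← connected u v with l , _ , w ← reach⇒walk (adj G) k r = l , w

  abstract
    project : ∀ u → ∃[ j ] j ≤ d × ∃[ l ] Walk A₀ l u (p j)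
    project u = foot (proj₂ (walk-between u (p 0)))

  π : Fin N → ℕ
  π u = proj₁ (project u)

  π≤d : ∀ u → π u ≤ d
  π≤d u = proj₁ (proj₂ (project u))

  abstract
    t : Fin N → ℕ
    t u = distA A₀ u (p (π u))

    descent : ∀ u → Walk A₀ (t u) u (p (π u))
    descent u = distA-walk (proj₂ (proj₂ (proj₂ (project u))))

    t-least : ∀ {u k} → Walk A₀ k u (p (π u)) → t u ≤ k
    t-least = distA-≤

  A₀-π : ∀ {u v} → A₀ u v ≡ true → π u ≡ π v
  A₀-π {u} {v} a = same-foot (π≤d u) (π≤d v) (walk-++ (walk-reverse A₀-sym (descent u)) (step a (descent v)))

  A₀-t : ∀ {u v} → A₀ u v ≡ true → t u ≤ suc (t v)
  A₀-t {u} {v} a = t-least (step a (subst (λ j → Walk A₀ (t v) v (p j)) (sym (A₀-π a)) (descent v)))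

  π-p : ∀ {i} → i ≤ d → π (p i) ≡ i
  π-p {i} i≤d = sym (same-foot i≤d (π≤d (p i)) (descent (p i)))

  t-p : ∀ {i} → i ≤ d → t (p i) ≡ 0
  t-p {i} i≤d = n≤0⇒n≡0 (t-least (subst (λ j → Walk A₀ 0 (p i) (p j)) (sym (π-p i≤d)) stop))

  depth-level : ∀ u k → k ≤ t u → ∃[ w ] π w ≡ π u × t w ≡ k
  depth-level u k k≤ = go (t u) u refl k≤
    where
    next : ∀ {m w} → Walk A₀ (suc m) w (p (π w)) → t w ≡ suc m → ∃[ w′ ] π w′ ≡ π w × t w′ ≡ m
    next {m} (step {w = w′} a q) tw = w′ , sym (A₀-π a) ,
      ≤-antisym (t-least (subst (λ j → Walk A₀ m w′ (p j)) (A₀-π a) q)) (≤-pred (≤-trans (≡⇒≥ tw) (A₀-t a)))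
    go : ∀ m w → t w ≡ m → k ≤ m → ∃[ w′ ] π w′ ≡ π w × t w′ ≡ k
    go m w tw k≤m with m≤n⇒m<n∨m≡n k≤m
    ... | inj₂ refl = w , refl , tw
    go (suc m) w tw k≤m | inj₁ k<m
      with w′ , πw′ , tw′ ← next (subst (λ l → Walk A₀ l w (p (π w))) tw (descent w)) tw
      with w″ , πw″ , tw″ ← go m w′ tw′ (≤-pred k<m) = w″ , trans πw″ πw′ , tw″

  walk-apart : ∀ {k u v} → Walk (adj G) k u v → Apart (t u) (π u) (t v) (π v) k
  walk-apart stop = (λ _ → m≤m+n _ _ , m≤m+n _ _) , λ ne → contradiction refl ne
  walk-apart {suc k} {u} {v} (step {w = w} a q) = cases (adj-cases a)
    where
    jump : ∀ {x y} → x ≢ y → x ≤ suc y → y ≤ suc x → t u ≡ 0 → π u ≡ x → t w ≡ 0 → π w ≡ y →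
      Apart (t u) (π u) (t v) (π v) (suc k)
    jump x≢y p₁ p₂ tu πu tw πw = subst₂ (λ b y → Apart b y (t v) (π v) (suc k)) (sym tu) (sym πu)
      (apart-jump x≢y p₁ p₂ (subst₂ (λ b y → Apart b y (t v) (π v) k) tw πw (walk-apart q)))
    cases : A₀ u w ≡ true ⊎ (∃[ g ] g < d × u ≡ p g × w ≡ p (suc g)) ⊎ (∃[ g ] g < d × w ≡ p g × u ≡ p (suc g)) →
      Apart (t u) (π u) (t v) (π v) (suc k)
    cases (inj₁ a₀) = subst (λ y → Apart (t u) y (t v) (π v) (suc k)) (sym (A₀-π a₀))
      (apart-step (A₀-t a₀) (A₀-t (A₀-sym u w a₀)) (walk-apart q))
    cases (inj₂ (inj₁ (g , g<d , u≡ , w≡))) = jump (<⇒≢ ≤-refl) (m≤n⇒m≤1+n (n≤1+n g)) ≤-refl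
      (trans (cong t u≡) (t-p (<⇒≤ g<d))) (trans (cong π u≡) (π-p (<⇒≤ g<d)))
      (trans (cong t w≡) (t-p g<d)) (trans (cong π w≡) (π-p g<d))
    cases (inj₂ (inj₂ (g , g<d , w≡ , u≡))) = jump (<⇒≢ ≤-refl ∘ sym) ≤-refl (m≤n⇒m≤1+n (n≤1+n g))
      (trans (cong t u≡) (t-p g<d)) (trans (cong π u≡) (π-p g<d))
      (trans (cong t w≡) (t-p (<⇒≤ g<d))) (trans (cong π w≡) (π-p (<⇒≤ g<d)))

  dist-apart : ∀ {u v r} → dist G u v ≤ r → Apart (t u) (π u) (t v) (π v) r
  dist-apart {u} {v} d≤ = apart-mono d≤ (walk-apart (distA-walk (proj₂ (walk-between u v))))

  adjMinus⊆adj : ∀ M u v → adjMinus G M u v ≡ true → adj G u v ≡ true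
  adjMinus⊆adj M u v a = proj₁ (adjMinus-elim G M a)

  join : ∀ M → OnSpine M → ∀ {u v m} → π u + m ≡ π v → (∀ g → π u ≤ g → g < π v → edge g ∉ M) →
    Walk (adjMinus G M) (t u + m + t v) u v
  join M on {u} {v} {m} eq avoid =
    walk-++ (walk-++ (walk-map (A₀⊆ M on) (descent u))
                     (subst (λ j → Walk (adjMinus G M) m (p (π u)) (p j)) eq
                       (spine-walk M on (π u) m (≤-trans (≡⇒≤ eq) (π≤d v)) (λ g πu≤ g< → avoid g πu≤ (≤-trans g< (≡⇒≤ eq))))))
            (walk-reverse (adjMinus-sym G M) (walk-map (A₀⊆ M on) (descent v)))

  dist-join : ∀ {u v m} → π u + m ≡ π v → dist G u v ≤ t u + m + t v
  dist-join eq = distA-≤ (walk-map (adjMinus⊆adj []) (join [] (λ ()) eq (λ _ _ _ ())))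

  dist-join′ : ∀ {u v m} → π v + m ≡ π u → dist G u v ≤ t v + m + t u
  dist-join′ eq = distA-≤ (walk-reverse (adj-sym G) (walk-map (adjMinus⊆adj []) (join [] (λ ()) eq (λ _ _ _ ()))))

  spine-apart : ∀ u {i} → i ≤ d → Apart (t u) (π u) 0 i d
  spine-apart u {i} i≤d = subst₂ (λ b y → Apart (t u) (π u) b y d) (t-p i≤d) (π-p i≤d) (dist-apart (dist≤d u (p i)))

  t≤π : ∀ u → t u ≤ π u
  t≤π u = apart-end₀ (spine-apart u ≤-refl)

  t+π≤d : ∀ u → t u + π u ≤ d
  t+π≤d u = apart-end₁ (spine-apart u z≤n)

  spine-walk-apart : ∀ {i j k} → i ≤ d → j ≤ d → Walk (adj G) k (p i) (p j) → Apart 0 i 0 j k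
  spine-walk-apart {i} {j} {k} i≤d j≤d w = subst₂ (λ b y → Apart 0 i b y k) (t-p j≤d) (π-p j≤d)
    (subst₂ (λ a x → Apart a x (t (p j)) (π (p j)) k) (t-p i≤d) (π-p i≤d) (walk-apart w))

  -- Split-sets from tilings

  -- Vertices hanging below the segment are within `2 * r` of both of its ends, as a diametrical
  -- path of the component requires. Equivalently, they are within `r` of its centre, which is what
  -- the broadcast requires.
  Fits : ℕ → ℕ → Set
  Fits s r = ∀ u → s ≤ π u → π u ≤ s + 2 * r → s + t u ≤ π u × t u + π u ≤ s + 2 * r

  cuts : ∀ {s k} → Tiling Fits d s k → List ℕ
  cuts (last _ _ _ _)        = []
  cuts (cut {s} r _ _ _ T) = s + 2 * r ∷ cuts T

  cuts-bounds : ∀ {s k} (T : Tiling Fits d s k) {q} → q ∈ cuts T → s ≤ q × q < d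
  cuts-bounds (cut {s} r _ _ q<d T) (here refl) = m≤m+n s (2 * r) , q<d
  cuts-bounds (cut {s} r _ _ q<d T) (there q∈) with ≤q , q<d′ ← cuts-bounds T q∈ = ≤-trans (m≤n⇒m≤1+n (m≤m+n s (2 * r))) ≤q , q<d′

  cutEdges : ∀ {s k} → Tiling Fits d s k → List (Edge G)
  cutEdges T = map edge (cuts T)

  length-cutEdges : ∀ {s k} (T : Tiling Fits d s k) → length (cutEdges T) ≡ k
  length-cutEdges (last _ _ _ _)  = refl
  length-cutEdges (cut _ _ _ _ T) = cong suc (length-cutEdges T)

  cutEdges-unique : ∀ {s k} (T : Tiling Fits d s k) → Unique (cutEdges T)
  cutEdges-unique (last _ _ _ _)        = AllPairs.[]
  cutEdges-unique (cut {s} r _ _ q<d T) = All.tabulate distinct AllPairs.∷ cutEdges-unique T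
    where
    distinct : ∀ {e} → e ∈ cutEdges T → edge (s + 2 * r) ≢ e
    distinct e∈ eq with q , q∈ , refl ← ∈-map⁻ edge e∈ with q< , q<d′ ← cuts-bounds T q∈ =
      <-irrefl (p-injective (<⇒≤ q<d) (<⇒≤ q<d′) (cong proj₁ eq)) q<

  record Segment (s₀ : ℕ) (Q : List ℕ) (j : ℕ) : Set where
    field
      s r    : ℕ
      1≤r    : 1 ≤ r
      fits   : Fits s r
      s₀≤s   : s₀ ≤ s
      s≤j    : s ≤ j
      j≤q    : j ≤ s + 2 * r
      q≤d    : s + 2 * r ≤ d
      start  : s ≡ s₀ ⊎ ∃[ g ] s ≡ suc g × g ∈ Q
      end    : s + 2 * r ≡ d ⊎ s + 2 * r ∈ Q
      uncut  : ∀ g → s ≤ g → g < s + 2 * r → g ∉ Q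

  segment : ∀ {s k} (T : Tiling Fits d s k) j → s ≤ j → j ≤ d → Segment s (cuts T) j
  segment (last {s} r 1≤r ft eq) j s≤j j≤d = record
    { s = s ; r = r ; 1≤r = 1≤r ; fits = ft ; s₀≤s = ≤-refl ; s≤j = s≤j ; j≤q = ≤-trans j≤d (≡⇒≥ eq)
    ; q≤d = ≡⇒≤ eq ; start = inj₁ refl ; end = inj₁ eq ; uncut = λ _ _ _ () }
  segment (cut {s} r 1≤r ft q<d T) j s≤j j≤d with j ≤? s + 2 * r
  ... | yes j≤q = record
    { s = s ; r = r ; 1≤r = 1≤r ; fits = ft ; s₀≤s = ≤-refl ; s≤j = s≤j ; j≤q = j≤q
    ; q≤d = <⇒≤ q<d ; start = inj₁ refl ; end = inj₂ (here refl) ; uncut = no-cut }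
    where
    no-cut : ∀ g → s ≤ g → g < s + 2 * r → g ∉ s + 2 * r ∷ cuts T
    no-cut g _ g< (here refl) = <-irrefl refl g<
    no-cut g _ g< (there g∈)  = <-asym g< (proj₁ (cuts-bounds T g∈))
  ... | no j≰q = record
    { s = S.s ; r = S.r ; 1≤r = S.1≤r ; fits = S.fits ; s₀≤s = ≤-trans (m≤n⇒m≤1+n (m≤m+n s (2 * r))) S.s₀≤s
    ; s≤j = S.s≤j ; j≤q = S.j≤q ; q≤d = S.q≤d ; start = inj₂ (start′ S.start) ; end = end′ S.end ; uncut = no-cut }
    where
    module S = Segment (segment T j (≰⇒> j≰q) j≤d)
    start′ : S.s ≡ suc (s + 2 * r) ⊎ (∃[ g ] S.s ≡ suc g × g ∈ cuts T) → ∃[ g ] S.s ≡ suc g × g ∈ s + 2 * r ∷ cuts T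
    start′ (inj₁ eq)            = s + 2 * r , eq , here refl
    start′ (inj₂ (g , eq , g∈)) = g , eq , there g∈
    end′ : S.s + 2 * S.r ≡ d ⊎ S.s + 2 * S.r ∈ cuts T → S.s + 2 * S.r ≡ d ⊎ S.s + 2 * S.r ∈ s + 2 * r ∷ cuts T
    end′ (inj₁ eq) = inj₁ eq
    end′ (inj₂ q∈) = inj₂ (there q∈)
    no-cut : ∀ g → S.s ≤ g → g < S.s + 2 * S.r → g ∉ s + 2 * r ∷ cuts T
    no-cut g s≤g _ (here refl) = <-irrefl refl (≤-trans S.s₀≤s s≤g)
    no-cut g s≤g g< (there g∈) = S.uncut g s≤g g< g∈

  module Component {k} (T : Tiling Fits d 0 k) (c : Fin N) where

    M : List (Edge G)
    M = cutEdges T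

    open Segment (segment T (π c) z≤n (π≤d c))

    q : ℕ
    q = s + 2 * r

    on-spine : OnSpine M
    on-spine e∈ with g , g∈ , eq ← ∈-map⁻ edge e∈ = g , proj₂ (cuts-bounds T g∈) , eq

    edge∈⇒cut : ∀ {g} → g < d → edge g ∈ M → g ∈ cuts T
    edge∈⇒cut {g} g<d e∈ with g′ , g′∈ , eq ← ∈-map⁻ edge e∈ =
      subst (_∈ cuts T) (sym (p-injective (<⇒≤ g<d) (<⇒≤ (proj₂ (cuts-bounds T g′∈))) (cong proj₁ eq))) g′∈

    Inside : Fin N → Set
    Inside u = s ≤ π u × π u ≤ q

    p-inside : ∀ {i} → i ≤ d → s ≤ i → i ≤ q → Inside (p i)
    p-inside i≤d s≤i i≤q = subst (s ≤_) (sym (π-p i≤d)) s≤i , subst (_≤ q) (sym (π-p i≤d)) i≤q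

    -- An edge leaving the branches of the segment is an edge of the path at one of its ends; there
    -- the path either stops or has been cut.
    stays : ∀ {u v} → adjMinus G M u v ≡ true → Inside u → Inside v
    stays {u} {v} a (s≤ , ≤q) with a′ , n₁ , n₂ ← adjMinus-elim G M a with adj-cases a′
    ... | inj₁ a₀ = subst (s ≤_) (A₀-π a₀) s≤ , subst (_≤ q) (A₀-π a₀) ≤q
    ... | inj₂ (inj₁ (g , g<d , refl , refl)) = p-inside g<d (m≤n⇒m≤1+n s≤g) (up (m≤n⇒m<n∨m≡n (subst (_≤ q) (π-p (<⇒≤ g<d)) ≤q)) end)
      where
      s≤g : s ≤ g
      s≤g = subst (s ≤_) (π-p (<⇒≤ g<d)) s≤
      up : g < q ⊎ g ≡ q → q ≡ d ⊎ q ∈ cuts T → suc g ≤ q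
      up (inj₁ g<q) _ = g<q
      up (inj₂ g≡q) (inj₁ q≡d) = contradiction g<d (≤⇒≯ (≡⇒≥ (trans g≡q q≡d)))
      up (inj₂ g≡q) (inj₂ q∈)  = contradiction (∈-map⁺ edge (subst (_∈ cuts T) (sym g≡q) q∈)) n₁
    ... | inj₂ (inj₂ (g , g<d , refl , refl)) = p-inside (<⇒≤ g<d) (down (m≤n⇒m<n∨m≡n (subst (s ≤_) (π-p g<d) s≤)) start)
            (≤-trans (n≤1+n g) (subst (_≤ q) (π-p g<d) ≤q))
      where
      down : s < suc g ⊎ s ≡ suc g → s ≡ 0 ⊎ (∃[ g′ ] s ≡ suc g′ × g′ ∈ cuts T) → s ≤ g
      down (inj₁ s<) _ = ≤-pred s<
      down (inj₂ eq) (inj₁ s≡0) = contradiction (trans (sym eq) s≡0) λ ()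
      down (inj₂ eq) (inj₂ (g′ , eq′ , g′∈)) =
        contradiction (∈-map⁺ edge (subst (_∈ cuts T) (cong pred (trans (sym eq′) eq)) g′∈)) n₂

    walk-stays : ∀ {l u v} → Walk (adjMinus G M) l u v → Inside u → Inside v
    walk-stays stop       i = i
    walk-stays (step a w) i = walk-stays w (stays a i)

    -- The depth of `u` is at most the distance of its foot from the left end, that of `v` at most
    -- the distance of its foot from the right end. So the walk through both feet is no longer than
    -- the segment.
    ordered : ∀ {u v} → π u ≤ π v → Inside u → Inside v → ∃[ l ] l ≤ 2 * r × Walk (adjMinus G M) l u v
    ordered {u} {v} u≤v (s≤u , u≤q) (s≤v , v≤q) with m , eq ← m≤n⇒∃[o]m+o≡n u≤v =
      t u + m + t v , ar s r (t u) (t v) (π u) (π v) m eq (proj₁ (fits u s≤u u≤q)) (proj₂ (fits v s≤v v≤q)) ,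
      join M on-spine eq (λ g πu≤ g< e∈ →
        uncut g (≤-trans s≤u πu≤) (≤-trans g< v≤q) (edge∈⇒cut (≤-trans g< (π≤d v)) e∈))
      where
      ar : ∀ s r a b x y m → x + m ≡ y → s + a ≤ x → b + y ≤ s + 2 * r → a + m + b ≤ 2 * r
      ar s r a b x y m refl p q = lin 0 (p ⊕ q) (solve (s ∷ r ∷ a ∷ b ∷ x ∷ m ∷ []))

    within : ∀ {u v} → Inside u → Inside v → ∃[ l ] l ≤ 2 * r × Walk (adjMinus G M) l u v
    within {u} {v} iu iv with ≤-total (π u) (π v)
    ... | inj₁ u≤v = ordered u≤v iu iv
    ... | inj₂ v≤u with l , l≤ , w ← ordered v≤u iv iu = l , l≤ , walk-reverse (adjMinus-sym G M) w

    c-inside : Inside c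
    c-inside = s≤j , j≤q

    sameComp⇒inside : ∀ {u} → sameComp G M c u ≡ true → Inside u
    sameComp⇒inside eq with l , _ , w ← reach⇒walk (adjMinus G M) N eq = walk-stays w c-inside

    inside⇒sameComp : ∀ {u} → Inside u → sameComp G M c u ≡ true
    inside⇒sameComp iu with _ , _ , w ← within c-inside iu with l , l<N , w′ ← shorten w = walk⇒reach w′ (<⇒≤ l<N)

    comp : List (Fin N)
    comp = filterᵇ (sameComp G M c) (allFin N)

    inside⇒∈comp : ∀ {u} → Inside u → u ∈ comp
    inside⇒∈comp {u} iu = ∈-filter⁺ (λ v → T? (sameComp G M c v)) (∈-allFin u) (Equivalence.from T-≡ (inside⇒sameComp iu))

    ∈comp⇒inside : ∀ {u} → u ∈ comp → Inside u
    ∈comp⇒inside u∈ = sameComp⇒inside (Equivalence.to T-≡ (proj₂ (∈-filter⁻ (λ v → T? (sameComp G M c v)) {xs = allFin N} u∈)))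

    compDiam≡ : 2 * r ≡ compDiam G M c
    compDiam≡ = ≤-antisym
      (≤-trans far (foldr-⊔-upper (∈-concatMap⁺ _ (lose (inside⇒∈comp s-inside) (∈-map⁺ _ (inside⇒∈comp q-inside))))))
      (foldr-⊔-least below)
      where
      s≤d : s ≤ d
      s≤d = ≤-trans (m≤m+n s (2 * r)) q≤d
      s-inside : Inside (p s)
      s-inside = p-inside s≤d ≤-refl (m≤m+n s (2 * r))
      q-inside : Inside (p q)
      q-inside = p-inside q≤d (m≤m+n s (2 * r)) ≤-refl
      s≢q : s ≢ q
      s≢q eq = contradiction (+-cancelˡ-≤ s (2 * r) 0 (≤-trans (≡⇒≥ eq) (≡⇒≥ (+-identityʳ s)))) (<⇒≱ (≤-trans 1≤r (m≤m+n r _)))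
      ar : ∀ s r k → s + 2 * r + 0 ≤ k + s → 2 * r ≤ k
      ar s r k p = lin 0 p (solve (s ∷ r ∷ k ∷ []))
      far : 2 * r ≤ distA (adjMinus G M) (p s) (p q)
      far = ar s r _ (proj₂ (proj₂ (spine-walk-apart s≤d q≤d (walk-map (adjMinus⊆adj M)
        (distA-walk (proj₂ (proj₂ (within s-inside q-inside)))))) s≢q))
      below : ∀ {y} → y ∈ concatMap (λ u → map (λ v → distA (adjMinus G M) u v) comp) comp → y ≤ 2 * r
      below y∈ with u , u∈ , y∈′ ← find (∈-concatMap⁻ _ {xs = comp} y∈)
               with v , v∈ , refl ← ∈-map⁻ _ y∈′
               with l , l≤ , w ← within (∈comp⇒inside u∈) (∈comp⇒inside v∈) = ≤-trans (distA-≤ w) l≤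

    length-comp : length (filterᵇ (sameComp G M c) (applyUpTo p (suc d))) ≡ suc (2 * r)
    length-comp with o , eq ← m≤n⇒∃[o]m+o≡n q≤d = trans (length-filterᵇ (sameComp G M c) p (suc d))
      (trans (cong (sumTo χ) (trans (cong suc (sym eq)) (ar s (2 * r) o)))
      (trans (sumTo-split χ (s + suc (2 * r)) o)
      (trans (cong₂ _+_ (trans (sumTo-split χ s (suc (2 * r))) (cong₂ _+_ before inside)) after) (+-identityʳ _))))
      where
      χ : ℕ → ℕ
      χ i = if sameComp G M c (p i) then 1 else 0
      ar : ∀ a b o → suc (a + b + o) ≡ a + suc b + o
      ar a b o = solve (a ∷ b ∷ o ∷ [])
      χ-out : ∀ {i} → i ≤ d → ¬ (s ≤ i × i ≤ q) → χ i ≡ 0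
      χ-out {i} i≤d out with sameComp G M c (p i) in e
      ... | false = refl
      ... | true with s≤ , ≤q ← sameComp⇒inside e = contradiction (subst (s ≤_) (π-p i≤d) s≤ , subst (_≤ q) (π-p i≤d) ≤q) out
      before : sumTo χ s ≡ 0
      before = sumTo-zero s λ i i<s → χ-out (≤-trans (<⇒≤ i<s) (≤-trans (m≤m+n s (2 * r)) q≤d)) λ (s≤i , _) → <⇒≱ i<s s≤i
      inside : sumTo (λ i → χ (s + i)) (suc (2 * r)) ≡ suc (2 * r)
      inside = trans (sumTo-cong (suc (2 * r)) λ i i< → cong (λ b → if b then 1 else 0)
          (inside⇒sameComp (p-inside (≤-trans (+-monoʳ-≤ s (≤-pred i<)) q≤d) (m≤m+n s i) (+-monoʳ-≤ s (≤-pred i<)))))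
        (trans (sumTo-const 1 (suc (2 * r))) (*-identityʳ _))
      after : sumTo (λ i → χ (s + suc (2 * r) + i)) o ≡ 0
      after = sumTo-zero o λ i i<o → χ-out (bound i i<o) λ (_ , ≤q) →
        <⇒≱ (≤-trans (s≤s (m≤m+n (2 * r) i)) ≤-refl) (+-cancelˡ-≤ s (suc (2 * r) + i) (2 * r) (≤-trans (≡⇒≥ (+-assoc s _ i)) ≤q))
        where
        bound : ∀ i → i < o → s + suc (2 * r) + i ≤ d
        bound i i<o = ≤-trans (≡⇒≤ (trans (cong (_+ i) (+-suc s (2 * r))) (sym (+-suc q i)))) (≤-trans (+-monoʳ-≤ q i<o) (≡⇒≤ eq))

    good : GoodComponent G (applyUpTo p (suc d)) M c
    good = 2 * r , length-comp , ≤-trans 1≤r (m≤m+n r _) , divides r (*-comm 2 r) , compDiam≡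

  abstract
    splitSet : ∀ {k} (T : Tiling Fits d 0 k) → 1 ≤ k → DiamPath G (applyUpTo p (suc d)) → IsSplitSet G (cutEdges T)
    splitSet {k} T 1≤k diamPath = applyUpTo p (suc d) , diamPath , All.tabulate edgeOf , cutEdges-unique T ,
      ≤-trans 1≤k (≡⇒≥ (length-cutEdges T)) , Component.good T
      where
      edgeOf : ∀ {e} → e ∈ cutEdges T → EdgeOf G (applyUpTo p (suc d)) e
      edgeOf e∈ with q , q∈ , refl ← ∈-map⁻ edge e∈ = edgeOf-applyUpTo G p (proj₂ (cuts-bounds T q∈))

  -- Balls along the path that touch without overlapping

  -- Weights w on the spine positions. Two positions touch when their balls meet only in boundary vertices.
  Touched : (ℕ → ℕ) → ℕ → Set
  Touched w j = ∃[ k ] 0 < w k × (j + w j + w k ≡ k ⊎ k + w k + w j ≡ j)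

  -- Every position touches another one, or would touch the centre of a segment ending at s − 1
  -- whose radius is increased by δ.
  TailTouched : ℕ → ℕ → (ℕ → ℕ) → Set
  TailTouched δ s w = ∀ j → 0 < w j → Touched w j ⊎ s + w j + δ ≡ suc j

  -- `ε` allows balls to reach to the left of `s`, that is over the cut edge before the segment
  -- starting at `s`. By `packed` the radii of two balls add up to at most the distance of their
  -- centres.
  record Layout (s ε c : ℕ) (w : ℕ → ℕ) : Set where
    field
      support  : ∀ j → 0 < w j → s ≤ j × j ≤ d
      overhang : ∀ j → 0 < w j → s + w j ≤ j + ε
      packed   : ∀ i j → i < j → 0 < w i → 0 < w j → i + w i + w j ≤ j
      covers   : ∀ u → s ≤ π u → ∃[ j ] 0 < w j × j + t u ≤ π u + w j × π u + t u ≤ j + w j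
      total    : sumTo w (suc d) ≡ c

  empty-layout : ∀ {q} → q ≡ d → Layout (suc q) 0 0 (λ _ → 0)
  empty-layout refl = record
    { support = λ _ () ; overhang = λ _ () ; packed = λ _ _ _ ()
    ; covers = λ u d<π → contradiction (π≤d u) (<⇒≱ d<π) ; total = sumTo-zero (suc d) (λ _ _ → refl) }

  -- The new ball ends at `s + 2 * r + δ`, and those to its right begin no earlier than at s + 2 r +
  -- 1 - ε. So `δ + ε ≤ 1` says that at most one of two neighbours extends over the cut edge between
  -- them.
  module Prepend {s r δ ε c w′} (1≤r : 1 ≤ r) (δ+ε≤1 : δ + ε ≤ 1) (fits : Fits s r) (q≤d : s + 2 * r ≤ d)
    (L : Layout (suc (s + 2 * r)) ε c w′) where

    private module L = Layout L

    a : ℕ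
    a = s + r

    w : ℕ → ℕ
    w j = spike a (r + δ) j + w′ j

    a≤q : a ≤ s + 2 * r
    a≤q = +-monoʳ-≤ s (m≤m+n r _)

    w′-pos⇒≢a : ∀ {j} → 0 < w′ j → j ≢ a
    w′-pos⇒≢a {j} 0<w′ refl = <⇒≱ (proj₁ (L.support a 0<w′)) a≤q

    w-a : w a ≡ r + δ
    w-a = trans (cong₂ _+_ (spike-at a (r + δ)) (n≤0⇒n≡0 (≮⇒≥ λ 0<w′ → w′-pos⇒≢a 0<w′ refl))) (+-identityʳ (r + δ))

    w-off : ∀ {j} → j ≢ a → w j ≡ w′ j
    w-off {j} j≢a = cong (_+ w′ j) (spike-off j≢a)

    w-rest : ∀ {j} → 0 < w′ j → w j ≡ w′ j
    w-rest = w-off ∘ w′-pos⇒≢a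

    rest-pos : ∀ {j} → 0 < w′ j → 0 < w j
    rest-pos 0<w′ = ≤-trans 0<w′ (≡⇒≥ (w-rest 0<w′))

    a-pos : 0 < w a
    a-pos = ≤-trans (≤-trans 1≤r (m≤m+n r δ)) (≡⇒≥ w-a)

    view : ∀ j → 0 < w j → j ≡ a ⊎ 0 < w′ j
    view j 0<w with j ≟ a
    ... | yes j≡a = inj₁ j≡a
    ... | no  _   = inj₂ 0<w

    support : ∀ j → 0 < w j → s ≤ j × j ≤ d
    support j 0<w with view j 0<w
    ... | inj₁ refl = m≤m+n s r , ≤-trans a≤q q≤d
    ... | inj₂ 0<w′ with q<j , j≤d ← L.support j 0<w′ = ≤-trans (m≤m+n s _) (<⇒≤ q<j) , j≤d

    overhang : ∀ j → 0 < w j → s + w j ≤ j + δ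
    overhang j 0<w with view j 0<w
    ... | inj₁ refl = ≡⇒≤ (trans (cong (s +_) w-a) (sym (+-assoc s r δ)))
    ... | inj₂ 0<w′ = ≤-trans (≡⇒≤ (cong (s +_) (w-rest 0<w′))) (ar s r δ ε (w′ j) j δ+ε≤1 (L.overhang j 0<w′))
      where
      ar : ∀ s r δ ε x j → δ + ε ≤ 1 → suc (s + 2 * r) + x ≤ j + ε → s + x ≤ j + δ
      ar s r δ ε x j p q = lin (2 * r + δ + δ) (p ⊕ q) (solve (s ∷ r ∷ δ ∷ ε ∷ x ∷ j ∷ []))

    packed : ∀ i j → i < j → 0 < w i → 0 < w j → i + w i + w j ≤ j
    packed i j i<j 0<wi 0<wj with view i 0<wi | view j 0<wj
    ... | inj₁ refl | inj₁ refl = contradiction i<j (<-irrefl refl)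
    ... | inj₂ 0<w′ | inj₁ refl = contradiction i<j (<-asym (≤-trans (s≤s a≤q) (proj₁ (L.support i 0<w′))))
    ... | inj₂ 0<w₁ | inj₂ 0<w₂ = ≤-trans (≡⇒≤ (cong₂ (λ x y → i + x + y) (w-rest 0<w₁) (w-rest 0<w₂))) (L.packed i j i<j 0<w₁ 0<w₂)
    ... | inj₁ refl | inj₂ 0<w′ = ≤-trans (≡⇒≤ (cong₂ (λ x y → a + x + y) w-a (w-rest 0<w′))) (ar s r δ ε (w′ j) j δ+ε≤1 (L.overhang j 0<w′))
      where
      ar : ∀ s r δ ε x j → δ + ε ≤ 1 → suc (s + 2 * r) + x ≤ j + ε → s + r + (r + δ) + x ≤ j
      ar s r δ ε x j p q = lin 0 (p ⊕ q) (solve (s ∷ r ∷ δ ∷ ε ∷ x ∷ j ∷ []))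

    covers : ∀ u → s ≤ π u → ∃[ j ] 0 < w j × j + t u ≤ π u + w j × π u + t u ≤ j + w j
    covers u s≤π with π u ≤? s + 2 * r
    ... | yes π≤q with f₁ , f₂ ← fits u s≤π π≤q =
      a , a-pos , ≤-trans (ar₁ s r δ (t u) (π u) f₁) (≡⇒≥ (cong (π u +_) w-a)) , ≤-trans (ar₂ s r δ (t u) (π u) f₂) (≡⇒≥ (cong (a +_) w-a))
      where
      ar₁ : ∀ s r δ t x → s + t ≤ x → s + r + t ≤ x + (r + δ)
      ar₁ s r δ t x p = lin δ p (solve (s ∷ r ∷ δ ∷ t ∷ x ∷ []))
      ar₂ : ∀ s r δ t x → t + x ≤ s + 2 * r → x + t ≤ s + r + (r + δ)
      ar₂ s r δ t x p = lin δ p (solve (s ∷ r ∷ δ ∷ t ∷ x ∷ []))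
    ... | no π≰q with j , 0<w′ , c₁ , c₂ ← L.covers u (≰⇒> π≰q) =
      j , rest-pos 0<w′ , ≤-trans c₁ (≡⇒≥ (cong (π u +_) (w-rest 0<w′))) , ≤-trans c₂ (≡⇒≥ (cong (j +_) (w-rest 0<w′)))

    layout : Layout s δ (r + δ + c) w
    layout = record
      { support = support ; overhang = overhang ; packed = packed ; covers = covers
      ; total = trans (sumTo-add (spike a (r + δ)) w′ (suc d)) (cong₂ _+_ (sumTo-spike a (r + δ) (s≤s (≤-trans a≤q q≤d))) L.total) }

    touch-arith : ∀ s r δ x j → suc (s + 2 * r) + x + δ ≡ suc j → s + r + (r + δ) + x ≡ j
    touch-arith s r δ x j p = trans (ar s r δ x) (cong pred p)
      where
      ar : ∀ s r δ x → s + r + (r + δ) + x ≡ s + 2 * r + x + δ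
      ar s r δ x = solve (s ∷ r ∷ δ ∷ x ∷ [])

    rest-touched : TailTouched δ (suc (s + 2 * r)) w′ → ∀ j → 0 < w′ j → Touched w j
    rest-touched tail j 0<w′ with tail j 0<w′
    ... | inj₁ (k , 0<wk , inj₁ eq) = k , rest-pos 0<wk , inj₁ (trans (cong₂ (λ x y → j + x + y) (w-rest 0<w′) (w-rest 0<wk)) eq)
    ... | inj₁ (k , 0<wk , inj₂ eq) = k , rest-pos 0<wk , inj₂ (trans (cong₂ (λ x y → k + x + y) (w-rest 0<wk) (w-rest 0<w′)) eq)
    ... | inj₂ eq = a , a-pos , inj₂ (trans (cong₂ (λ x y → a + x + y) w-a (w-rest 0<w′)) (touch-arith s r δ (w′ j) j eq))

    centre-touched : ∀ j → 0 < w′ j → suc (s + 2 * r) + w′ j + δ ≡ suc j → Touched w a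
    centre-touched j 0<w′ eq = j , rest-pos 0<w′ ,
      inj₁ (trans (cong₂ (λ x y → a + x + y) w-a (w-rest 0<w′)) (touch-arith s r δ (w′ j) j eq))

    -- The new ball begins at s - δ, a preceding one with increment `δ₀` would end at s - 1 + δ₀;
    -- these agree exactly if the increments add up to 1.
    tail-touched : ∀ δ₀ → δ + δ₀ ≡ 1 → TailTouched δ (suc (s + 2 * r)) w′ → TailTouched δ₀ s w
    tail-touched δ₀ δ+δ₀≡1 tail j 0<w with view j 0<w
    ... | inj₂ 0<w′ = inj₁ (rest-touched tail j 0<w′)
    ... | inj₁ refl = inj₂ (trans (cong (λ x → s + x + δ₀) w-a) (trans (ar s r δ δ₀) (trans (cong (s + r +_) δ+δ₀≡1) (+-comm (s + r) 1))))
      where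
      ar : ∀ s r δ δ₀ → s + (r + δ) + δ₀ ≡ s + r + (δ + δ₀)
      ar s r δ δ₀ = solve (s ∷ r ∷ δ ∷ δ₀ ∷ [])

  -- With increments 0 and 1 the second ball extends by one on both sides. It thus touches the first
  -- ball and supplies the contact that `tail` leaves open on its right.
  module Couple {s r r′ c w″} (1≤r : 1 ≤ r) (1≤r′ : 1 ≤ r′) (ft : Fits s r) (ft′ : Fits (suc (s + 2 * r)) r′)
    (q≤d : s + 2 * r ≤ d) (q′≤d : suc (s + 2 * r) + 2 * r′ ≤ d)
    (L : Layout (suc (suc (s + 2 * r) + 2 * r′)) 0 c w″)
    (tail : TailTouched 1 (suc (suc (s + 2 * r) + 2 * r′)) w″) where

    private
      module P = Prepend {δ = 1} 1≤r′ ≤-refl ft′ q′≤d L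
      module N = Prepend {δ = 0} 1≤r ≤-refl ft q≤d P.layout

    w : ℕ → ℕ
    w = N.w

    layout : Layout s 0 (r + 0 + (r′ + 1 + c)) w
    layout = N.layout

    touched : ∀ j → 0 < w j → Touched w j
    touched j 0<w with N.view j 0<w
    ... | inj₂ 0<w′ = N.rest-touched (P.tail-touched 0 refl tail) j 0<w′
    ... | inj₁ refl = N.centre-touched P.a P.a-pos
      (trans (cong (λ x → suc (s + 2 * r) + x + 0) P.w-a) (ar (suc (s + 2 * r)) r′))
      where
      ar : ∀ s r → s + (r + 1) + 0 ≡ suc (s + r)
      ar s r = solve (s ∷ r ∷ [])

  -- Increments 0 1 0, 0 1 0, … along the segments, the last one being 1 if it stands alone.
  record Plan (s k : ℕ) : Set where
    field
      ε c     : ℕ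
      w       : ℕ → ℕ
      ε≤1     : ε ≤ 1
      layout  : Layout s ε c w
      -- The index is 0 because in the recursion the preceding segment is the third of a triple,
      -- which is not increased. A plan for a single segment has no contact of its own and relies on
      -- this one.
      tail    : TailTouched 0 s w
      touched : 1 ≤ k → ∀ j → 0 < w j → Touched w j
      -- For s = 0 and d = 2 γ + k this reads c = γ + `increments k`.
      cost≡   : s + 2 * c + k ≡ d + 2 * increments k

  plan : ∀ {s k} → Tiling Fits d s k → Plan s k
  plan (last {s} r 1≤r ft q≡d) = record
    { ε≤1 = ≤-refl ; layout = P.layout ; tail = P.tail-touched 0 refl (λ _ ()) ; touched = λ ()
    ; cost≡ = trans (ar s r) (cong (_+ 2) q≡d) }
    where
    module P = Prepend {δ = 1} 1≤r ≤-refl ft (≡⇒≤ q≡d) (empty-layout q≡d)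
    ar : ∀ s r → s + 2 * (r + 1 + 0) + 0 ≡ s + 2 * r + 2
    ar s r = solve (s ∷ r ∷ [])
  plan (cut {s} r 1≤r ft q<d (last r′ 1≤r′ ft′ q≡d)) = record
    { ε≤1 = z≤n ; layout = C.layout ; tail = λ j 0<w → inj₁ (C.touched j 0<w) ; touched = λ _ → C.touched
    ; cost≡ = trans (ar s r r′) (cong (_+ 2) q≡d) }
    where
    module C = Couple 1≤r 1≤r′ ft ft′ (<⇒≤ q<d) (≡⇒≤ q≡d) (empty-layout q≡d) (λ _ ())
    ar : ∀ s r r′ → s + 2 * (r + 0 + (r′ + 1 + 0)) + 1 ≡ suc (s + 2 * r) + 2 * r′ + 2
    ar s r r′ = solve (s ∷ r ∷ r′ ∷ [])
  plan (cut {s} r 1≤r ft q<d (cut r′ 1≤r′ ft′ q′<d (last r″ 1≤r″ ft″ q≡d))) = record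
    { ε≤1 = z≤n ; layout = C.layout ; tail = λ j 0<w → inj₁ (C.touched j 0<w) ; touched = λ _ → C.touched
    ; cost≡ = trans (ar s r r′ r″) (cong (_+ 2) q≡d) }
    where
    module Z = Prepend {δ = 0} 1≤r″ z≤n ft″ (≡⇒≤ q≡d) (empty-layout q≡d)
    module C = Couple 1≤r 1≤r′ ft ft′ (<⇒≤ q<d) (<⇒≤ q′<d) Z.layout (Z.tail-touched 1 refl (λ _ ()))
    ar : ∀ s r r′ r″ → s + 2 * (r + 0 + (r′ + 1 + (r″ + 0 + 0))) + 2 ≡ suc (suc (s + 2 * r) + 2 * r′) + 2 * r″ + 2
    ar s r r′ r″ = solve (s ∷ r ∷ r′ ∷ r″ ∷ [])
  plan (cut {s} r 1≤r ft q<d (cut r′ 1≤r′ ft′ q′<d (cut {k = k} r″ 1≤r″ ft″ q″<d T))) = record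
    { ε≤1 = z≤n ; layout = C.layout ; tail = λ j 0<w → inj₁ (C.touched j 0<w) ; touched = λ _ → C.touched
    ; cost≡ = ar s r r′ r″ R.c k d (increments k) R.cost≡ }
    where
    module R = Plan (plan T)
    module Z = Prepend {δ = 0} 1≤r″ R.ε≤1 ft″ (<⇒≤ q″<d) R.layout
    module C = Couple 1≤r 1≤r′ ft ft′ (<⇒≤ q<d) (<⇒≤ q′<d) Z.layout (Z.tail-touched 1 refl R.tail)
    ar₀ : ∀ s r r′ r″ c k → s + 2 * (r + 0 + (r′ + 1 + (r″ + 0 + c))) + suc (suc (suc k))
        ≡ suc (suc (suc (s + 2 * r) + 2 * r′) + 2 * r″) + 2 * c + k + 2
    ar₀ s r r′ r″ c k = solve (s ∷ r ∷ r′ ∷ r″ ∷ c ∷ k ∷ [])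
    ar₁ : ∀ d i → d + 2 * i + 2 ≡ d + 2 * suc i
    ar₁ d i = solve (d ∷ i ∷ [])
    ar : ∀ s r r′ r″ c k d i → suc (suc (suc (s + 2 * r) + 2 * r′) + 2 * r″) + 2 * c + k ≡ d + 2 * i →
      s + 2 * (r + 0 + (r′ + 1 + (r″ + 0 + c))) + suc (suc (suc k)) ≡ d + 2 * suc i
    ar s r r′ r″ c k d i eq = trans (ar₀ s r r′ r″ c k) (trans (cong (_+ 2) eq) (ar₁ d i))

  -- From weights on the path to maximal bn-independent broadcasts

  dist-sym : ∀ u v → dist G u v ≡ dist G v u
  dist-sym u v = ≤-antisym (half u v) (half v u)
    where
    half : ∀ u v → dist G u v ≤ dist G v u
    half u v = distA-≤ (walk-reverse (adj-sym G) (distA-walk (proj₂ (walk-between v u))))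

  triangle : ∀ u v w → dist G u w ≤ dist G u v + dist G v w
  triangle u v w = distA-≤ (walk-++ (distA-walk (proj₂ (walk-between u v))) (distA-walk (proj₂ (walk-between v w))))

  dist-self : ∀ u → dist G u u ≡ 0
  dist-self u = n≤0⇒n≡0 (distA-≤ {A = adj G} stop)

  dist≤ecc : ∀ u v → dist G u v ≤ ecc G u
  dist≤ecc u v = foldr-⊔-upper (∈-map⁺ (dist G u) (∈-allFin v))

  spine-dist : ∀ i m → i + m ≤ d → dist G (p i) (p (i + m)) ≡ m
  spine-dist i m i+m≤d = ≤-antisym (distA-≤ walk) (far m i+m≤d)
    where
    walk : Walk (adj G) m (p i) (p (i + m))
    walk = walk-map (adjMinus⊆adj []) (spine-walk [] (λ ()) i m i+m≤d (λ _ _ _ ()))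
    far : ∀ m → i + m ≤ d → m ≤ dist G (p i) (p (i + m))
    far zero    _     = z≤n
    far (suc m) i+m≤d = ar i (suc m) _ (proj₂ (proj₂ (spine-walk-apart (≤-trans (m≤m+n i (suc m)) i+m≤d) i+m≤d
      (distA-walk (proj₂ (walk-between (p i) (p (i + suc m)))))) (<⇒≢ (m<m+n i (s≤s z≤n)))))
      where
      ar : ∀ i m k → i + m + 0 ≤ k + i → m ≤ k
      ar i m k q = lin 0 q (solve (i ∷ m ∷ k ∷ []))

  dist-spine-≤ : ∀ {u j r} → j ≤ d → j + t u ≤ π u + r → π u + t u ≤ j + r → dist G u (p j) ≤ r
  dist-spine-≤ {u} {j} {r} j≤d c₁ c₂ = near (≤-total (π u) j)
    where
    ar : ∀ x m y t b w → x + m ≡ y → b ≡ 0 → y + t ≤ x + w → t + m + b ≤ w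
    ar x m y t b w refl refl q = lin 0 q (solve (x ∷ m ∷ t ∷ w ∷ []))
    near : π u ≤ j ⊎ j ≤ π u → dist G u (p j) ≤ r
    near (inj₁ π≤j) with m , eq ← m≤n⇒∃[o]m+o≡n π≤j =
      ≤-trans (dist-join (trans eq (sym (π-p j≤d)))) (ar (π u) m j (t u) (t (p j)) r eq (t-p j≤d) c₁)
    near (inj₂ j≤π) with m , eq ← m≤n⇒∃[o]m+o≡n j≤π =
      ≤-trans (dist-join′ (trans (cong (_+ m) (π-p j≤d)) eq))
        (≤-trans (≡⇒≤ (trans (cong (λ x → x + m + t u) (t-p j≤d)) (trans (+-comm m (t u)) (sym (+-identityʳ (t u + m))))))
                 (ar j m (π u) (t u) 0 r eq refl c₂))

  -- `saturated` accounts for maximality and for the bound by the eccentricity: a ball can grow no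
  -- further because it touches another one or because it has already reached the eccentricity of
  -- its centre.
  module Weights (1≤d : 1 ≤ d) {w : ℕ → ℕ}
    (support : ∀ j → 0 < w j → j ≤ d)
    (packed : ∀ i j → i < j → 0 < w i → 0 < w j → i + w i + w j ≤ j)
    (covers : ∀ u → ∃[ j ] 0 < w j × j + t u ≤ π u + w j × π u + t u ≤ j + w j)
    (saturated : ∀ j → 0 < w j → Touched w j ⊎ ecc G (p j) ≡ w j) where

    abstract
      f : Fin N → ℕ
      f v = ind (v Finₚ.≟ p (π v)) * w (π v)

      f-p : ∀ {j} → j ≤ d → f (p j) ≡ w j
      f-p {j} j≤d = trans (cong (_* w (π (p j))) (ind-one (p j Finₚ.≟ p (π (p j))) (cong p (sym (π-p j≤d)))))
        (trans (+-identityʳ _) (cong w (π-p j≤d)))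

      f-off : ∀ {v} → v ≢ p (π v) → f v ≡ 0
      f-off {v} v≢ = cong (_* w (π v)) (ind-no (v Finₚ.≟ p (π v)) v≢)

      f-pos : ∀ {v} → 0 < f v → v ≡ p (π v) × 0 < w (π v)
      f-pos {v} 0<f with v Finₚ.≟ p (π v)
      ... | yes v≡ = v≡ , ≤-trans 0<f (≡⇒≤ (+-identityʳ (w (π v))))

    f-centre : ∀ {v} → 0 < f v → ∃[ j ] j ≤ d × v ≡ p j × 0 < w j
    f-centre {v} 0<f with v≡ , 0<w ← f-pos 0<f = π v , π≤d v , v≡ , 0<w

    cost≡ : cost G f ≡ sumTo w (suc d)
    cost≡ = trans (sum-allFin f) (trans (sumF-cong (λ v → sym (sumTo-spike (π v) (f v) (s≤s (π≤d v)))))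
      (trans (sym (sumTo-sumF-swap (λ j v → spike (π v) (f v) j) (suc d))) (sumTo-cong (suc d) (λ j j≤d → column j (≤-pred j≤d)))))
      where
      column : ∀ j → j ≤ d → sumF (λ v → spike (π v) (f v) j) ≡ w j
      column j j≤d = trans (sumF-single (λ v → spike (π v) (f v) j) (p j) off) (trans (spike-same (sym (π-p j≤d))) (f-p j≤d))
        where
        off : ∀ v → v ≢ p j → spike (π v) (f v) j ≡ 0
        off v v≢ with j ≟ π v
        ... | yes refl = trans (+-identityʳ (f v)) (f-off v≢)
        ... | no  _    = refl

    spread : ∀ {i j} → i < j → i ≤ d → j ≤ d → 0 < w i → 0 < w j → w i + w j ≤ dist G (p i) (p j)
    spread {i} {j} i<j i≤d j≤d 0<wi 0<wj with m , refl ← m≤n⇒∃[o]m+o≡n (<⇒≤ i<j) =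
      ≤-trans (+-cancelˡ-≤ i (w i + w (i + m)) m (≤-trans (≡⇒≥ (+-assoc i (w i) _)) (packed i (i + m) i<j 0<wi 0<wj)))
              (≡⇒≥ (spine-dist i m j≤d))

    disjoint : ∀ {u v} → u ≢ v → 0 < f u → 0 < f v → f u + f v ≤ dist G u v
    disjoint {u} {v} u≢v 0<fu 0<fv
      with i , i≤d , refl , 0<wi ← f-centre 0<fu
      with j , j≤d , refl , 0<wj ← f-centre 0<fv with <-cmp i j
    ... | tri≈ _ refl _ = contradiction refl u≢v
    ... | tri< i<j _ _ = ≤-trans (≡⇒≤ (cong₂ _+_ (f-p i≤d) (f-p j≤d))) (spread i<j i≤d j≤d 0<wi 0<wj)
    ... | tri> _ _ j<i = ≤-trans (≡⇒≤ (trans (cong₂ _+_ (f-p i≤d) (f-p j≤d)) (+-comm (w i) (w j))))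
                           (≤-trans (spread j<i j≤d i≤d 0<wj 0<wi) (≡⇒≤ (dist-sym (p j) (p i))))

    heard : ∀ u → ∃[ v ] Hears G f u v
    heard u with j , 0<w , c₁ , c₂ ← covers u =
      p j , ≤-trans 0<w (≡⇒≥ (f-p (support j 0<w))) , ≤-trans (dist-spine-≤ (support j 0<w) c₁ c₂) (≡⇒≥ (f-p (support j 0<w)))

    -- The common boundary vertex has two uses: its distance shows that the radius is at most the
    -- eccentricity, and it hears two centres as soon as neither is lowered, which blocks any
    -- increase.
    touching-point : ∀ {j} → j ≤ d → Touched w j →
      ∃[ x ] ∃[ k ] k ≤ d × p k ≢ p j × 0 < w k × dist G x (p j) ≡ w j × dist G x (p k) ≡ w k
    touching-point {j} j≤d (k , 0<wk , inj₁ eq) = p (j + w j) , k , k≤d , distinct , 0<wk ,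
      trans (dist-sym _ _) (spine-dist j (w j) j+≤d) , trans (cong (dist G (p (j + w j)) ∘ p) (sym eq)) (spine-dist (j + w j) (w k) (≤-trans (≡⇒≤ eq) k≤d))
      where
      k≤d = support k 0<wk
      j+≤d : j + w j ≤ d
      j+≤d = ≤-trans (m≤m+n (j + w j) (w k)) (≤-trans (≡⇒≤ eq) k≤d)
      distinct : p k ≢ p j
      distinct pk≡ = <-irrefl (sym (p-injective k≤d j≤d pk≡)) (≤-trans (m<m+n j 0<wk) (≤-trans (+-monoˡ-≤ (w k) (m≤m+n j (w j))) (≡⇒≤ eq)))
    touching-point {j} j≤d (k , 0<wk , inj₂ eq) = p (k + w k) , k , k≤d , distinct , 0<wk ,
      trans (cong (dist G (p (k + w k)) ∘ p) (sym eq)) (spine-dist (k + w k) (w j) (≤-trans (≡⇒≤ eq) j≤d)) , trans (dist-sym _ _) (spine-dist k (w k) k+≤d)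
      where
      k≤d = support k 0<wk
      k+≤d : k + w k ≤ d
      k+≤d = ≤-trans (m≤m+n (k + w k) (w j)) (≤-trans (≡⇒≤ eq) j≤d)
      distinct : p k ≢ p j
      distinct pk≡ = <-irrefl (p-injective k≤d j≤d pk≡) (≤-trans (m<m+n k 0<wk) (≤-trans (m≤m+n (k + w k) (w j)) (≡⇒≤ eq)))

    f≤ecc : ∀ v → f v ≤ ecc G v
    f≤ecc v with 0 <? f v
    ... | no ¬0<f = ≤-trans (≮⇒≥ ¬0<f) z≤n
    ... | yes 0<f with j , j≤d , refl , 0<w ← f-centre 0<f with saturated j 0<w
    ...   | inj₂ ecc≡ = ≡⇒≤ (trans (f-p j≤d) (sym ecc≡))
    ...   | inj₁ touch with x , _ , _ , _ , _ , eq , _ ← touching-point j≤d touch =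
      ≤-trans (≡⇒≤ (trans (f-p j≤d) (trans (sym eq) (dist-sym x (p j))))) (dist≤ecc (p j) x)

    p0≢p1 : p 0 ≢ p 1
    p0≢p1 eq = contradiction (p-injective z≤n 1≤d eq) λ ()

    isBroadcast : IsBroadcast G f
    isBroadcast = (λ _ → f≤ecc) , λ N≡1 → contradiction (fin-one N≡1 (p 0) (p 1)) p0≢p1

    bnIndependent : BnIndependent G f
    bnIndependent = isBroadcast , apart
      where
      clear : ∀ {x u v} → u ≢ v → 0 < f u → dist G x u ≤ f u → 0 < f v → f v ≤ dist G x v
      clear {x} {u} {v} u≢v 0<fu xu≤ 0<fv = +-cancelˡ-≤ (f u) (f v) (dist G x v)
        (≤-trans (disjoint u≢v 0<fu 0<fv) (≤-trans (triangle u x v) (+-monoˡ-≤ (dist G x v) (≤-trans (≡⇒≤ (dist-sym u x)) xu≤))))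
      apart : ∀ x → (∃[ u ] ∃[ v ] (u ≢ v × Hears G f x u × Hears G f x v)) → ∀ y → 0 < f y → f y ≤ dist G x y
      -- At least one of the two centres heard at `x` differs from `y`; since its ball contains `x`,
      -- disjointness and the triangle inequality bound `f y`.
      apart x (u , v , u≢v , (0<fu , xu≤) , (0<fv , xv≤)) y 0<fy with u Finₚ.≟ y
      ... | no u≢y   = clear u≢y 0<fu xu≤ 0<fy
      ... | yes refl = clear (u≢v ∘ sym) 0<fv xv≤ 0<fy

    maximal : MaximalBnIndependent G f
    maximal = bnIndependent , λ g g-bn f≤g k → k λ v → unchanged g g-bn f≤g v
      where
      module _ (g : Fin N → ℕ) (g-bn : BnIndependent G g) (f≤g : ∀ v → f v ≤ g v) where
        -- Under `g` the vertex `v` would hear both itself and the centre that it hears under `f`,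
        -- but its distance to itself is 0, less than `g v`.
        unraised-off : ∀ v → ¬ (0 < f v) → ¬ (f v < g v)
        unraised-off v ¬0<f f<g with u , 0<fu , vu≤ ← heard v =
          contradiction (proj₂ g-bn v (u , v , (λ { refl → ¬0<f 0<fu }) , (≤-trans 0<fu (f≤g u) , ≤-trans vu≤ (f≤g u)) ,
                                       (0<g , ≤-trans (≡⇒≤ (dist-self v)) z≤n)) v 0<g)
                        (<⇒≱ (≤-trans (s≤s (≡⇒≤ (dist-self v))) 0<g))
          where
          0<g : 0 < g v
          0<g = ≤-trans (s≤s z≤n) f<g
        unraised-on : ∀ {j} → j ≤ d → 0 < w j → ¬ (f (p j) < g (p j))
        unraised-on {j} j≤d 0<w f<g with saturated j 0<w
        ... | inj₂ ecc≡ = <⇒≱ f<g (≤-trans (proj₁ (proj₁ g-bn) (two-≤ p0≢p1) (p j)) (≡⇒≤ (trans ecc≡ (sym (f-p j≤d)))))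
        ... | inj₁ touch with x , k , k≤d , k≢j , 0<wk , xj , xk ← touching-point j≤d touch =
          <⇒≱ f<g (≤-trans (proj₂ g-bn x (p k , p j , k≢j , (≤-trans 0<wk wk≤ , ≤-trans (≡⇒≤ xk) wk≤) ,
                              (0<g , ≤-trans (≡⇒≤ xj) wj≤)) (p j) 0<g)
                     (≡⇒≤ (trans xj (sym (f-p j≤d)))))
          where
          wk≤ : w k ≤ g (p k)
          wk≤ = ≤-trans (≡⇒≥ (f-p k≤d)) (f≤g (p k))
          wj≤ : w j ≤ g (p j)
          wj≤ = ≤-trans (≡⇒≥ (f-p j≤d)) (f≤g (p j))
          0<g : 0 < g (p j)
          0<g = ≤-trans 0<w wj≤
        unchanged : ∀ v → g v ≡ f v
        unchanged v = ≤-antisym (≮⇒≥ (not-raised (0 <? f v))) (f≤g v)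
          where
          not-raised : Dec (0 < f v) → ¬ (f v < g v)
          not-raised (no ¬0<f) = unraised-off v ¬0<f
          not-raised (yes 0<f) with j , j≤d , refl , 0<w ← f-centre 0<f = unraised-on j≤d 0<w

  abstract
    -- With the centre at position `r` the vertex `p 0` is at distance exactly `r`, while `t≤π`,
    -- `t+π≤d` and `d ≤ r + r` keep everything else within `r`. So the radius is the eccentricity of
    -- the centre.
    radius-broadcast : 1 ≤ d → ∀ r → r ≤ d → d ≤ r + r → ∃[ f ] MaximalBnIndependent G f × cost G f ≡ r
    radius-broadcast 1≤d r r≤d d≤2r = W.f , W.maximal , trans W.cost≡ (sumTo-spike r r (s≤s r≤d))
      where
      1≤r : 1 ≤ r
      1≤r = n≢0⇒n>0 λ { refl → contradiction (≤-trans 1≤d d≤2r) λ () }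
      centre : ∀ {j} → 0 < spike r r j → j ≡ r
      centre {j} 0<w with j ≟ r
      ... | yes j≡r = j≡r
      near : ∀ u → dist G u (p r) ≤ r
      near u = dist-spine-≤ r≤d (≤-trans (+-monoʳ-≤ r (t≤π u)) (≡⇒≤ (+-comm r (π u))))
        (≤-trans (≡⇒≤ (+-comm (π u) (t u))) (≤-trans (t+π≤d u) d≤2r))
      ecc≡ : ecc G (p r) ≡ r
      ecc≡ = ≤-antisym (foldr-⊔-least least)
        (≤-trans (≡⇒≥ (trans (dist-sym (p r) (p 0)) (spine-dist 0 r r≤d))) (dist≤ecc (p r) (p 0)))
        where
        least : ∀ {y} → y ∈ map (dist G (p r)) (allFin N) → y ≤ r
        least y∈ with v , _ , refl ← ∈-map⁻ (dist G (p r)) y∈ = ≤-trans (≡⇒≤ (dist-sym (p r) v)) (near v)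
      module W = Weights 1≤d {spike r r}
        (λ j 0<w → ≤-trans (≡⇒≤ (centre 0<w)) r≤d)
        (λ i j i<j 0<wi 0<wj → contradiction (trans (centre 0<wi) (sym (centre 0<wj))) (<⇒≢ i<j))
        (λ u → r , ≤-trans 1≤r (≡⇒≥ (spike-at r r)) ,
          ≤-trans (+-monoʳ-≤ r (t≤π u)) (≡⇒≤ (trans (+-comm r (π u)) (cong (π u +_) (sym (spike-at r r))))) ,
          ≤-trans (≡⇒≤ (+-comm (π u) (t u))) (≤-trans (t+π≤d u) (≤-trans d≤2r (≡⇒≥ (cong (r +_) (spike-at r r))))))
        (λ j 0<w → inj₂ (subst (λ j → ecc G (p j) ≡ spike r r j) (sym (centre 0<w)) (trans ecc≡ (sym (spike-at r r)))))

    tiling-broadcast : ∀ {k} → 1 ≤ d → 1 ≤ k → Tiling Fits d 0 k →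
      ∃[ f ] MaximalBnIndependent G f × 2 * cost G f + k ≡ d + 2 * increments k
    tiling-broadcast {k} 1≤d 1≤k T = W.f , W.maximal , trans (cong (λ c → 2 * c + k) (trans W.cost≡ L.total)) P.cost≡
      where
      module P = Plan (plan T)
      module L = Layout P.layout
      module W = Weights 1≤d {P.w} (λ j 0<w → proj₂ (L.support j 0<w)) L.packed (λ u → L.covers u z≤n)
        (λ j 0<w → inj₁ (P.touched 1≤k j 0<w))

  -- Comparison with the cost of a dominating broadcast

  module Bound (1≤d : 1 ≤ d) (diamPath : DiamPath G (applyUpTo p (suc d)))
    (f : Fin N → ℕ) (dominating : Dominating G f)
    (m : ℕ) (splitSet≤m : ∀ M → IsSplitSet G M → length M ≤ m) where

    heard-apart : ∀ u → ∃[ v ] 0 < f v × Apart (t u) (π u) (t v) (π v) (f v)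
    heard-apart u with v , 0<f , d≤f ← dominating u = v , 0<f , dist-apart d≤f

    module L = Load d π t π≤d t≤π t+π≤d p π-p t-p depth-level f heard-apart
    module F = FreeEdges d L.e L.x L.h L.h≤ L.h+≤ L.reach-h L.occupied

    γ : ℕ
    γ = cost G f

    load≡γ : F.S (suc d) ≡ γ
    load≡γ = trans L.total (sym (sum-allFin f))

    fits : ∀ {s r} → s + 2 * r ≤ d → F.Fits s r → Fits s r
    fits _ ft u s≤ ≤q with f₁ , f₂ ← ft (π u) s≤ ≤q =
      ≤-trans (+-monoʳ-≤ _ (L.t≤h u)) f₁ , ≤-trans (+-monoˡ-≤ (π u) (L.t≤h u)) f₂

    Small : Set
    Small = ∃[ g ] MaximalBnIndependent G g × cost G g ≤ γ + ⌈ m + 1 /3⌉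

    single-ball-case : d ≤ γ + γ → γ ≤ d ⊎ d ≤ γ → Small
    single-ball-case d≤2γ (inj₁ γ≤d) =
      let g , g-max , cost≡ = radius-broadcast 1≤d γ γ≤d d≤2γ in g , g-max , ≤-trans (≡⇒≤ cost≡) (m≤m+n γ _)
    single-ball-case d≤2γ (inj₂ d≤γ) =
      let g , g-max , cost≡ = radius-broadcast 1≤d d ≤-refl (m≤m+n d d) in g , g-max , ≤-trans (≡⇒≤ cost≡) (≤-trans d≤γ (m≤m+n γ _))

    cut-case : ∀ k → d ≡ 2 * γ + suc k → Small
    cut-case k d≡ =
      let g , g-max , cost≡ = tiling-broadcast 1≤d (s≤s z≤n) tiled
      in g , g-max , ≤-trans (ar d γ k (cost G g) (increments (suc k)) d≡ cost≡) (+-monoʳ-≤ γ (increments-≤ k<m))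
      where
      tiled : Tiling Fits d 0 (suc k)
      tiled = tiling-map (λ {s} {r} → fits {s} {r}) (F.tiling (suc k) (trans d≡ (cong (λ z → 2 * z + suc k) (sym load≡γ))))
      k<m : suc k ≤ m
      k<m = ≤-trans (≡⇒≥ (length-cutEdges tiled)) (splitSet≤m (cutEdges tiled) (splitSet tiled (s≤s z≤n) diamPath))
      ar : ∀ d γ k c i → d ≡ 2 * γ + suc k → 2 * c + suc k ≡ d + 2 * i → c ≤ γ + i
      ar d γ k c i refl e = *-cancelˡ-≤ 2 (lin 0 (≡⇒≤ e) (solve (γ ∷ k ∷ c ∷ i ∷ [])))

    bound : Small
    bound with d ≤? γ + γ
    ... | yes d≤2γ = single-ball-case d≤2γ (≤-total γ d)
    ... | no d≰2γ with k , eq ← m≤n⇒∃[o]m+o≡n (≰⇒> d≰2γ) = cut-case k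
      (trans (sym eq) (trans (sym (+-suc (γ + γ) k)) (cong (λ z → γ + z + suc k) (sym (+-identityʳ γ)))))

-- Indexing the path of a split-set

enumerate : ∀ {A : Set} {m} (xs : List A) → length xs ≡ suc m → ∃[ p ] xs ≡ applyUpTo p (suc m)
enumerate {m = zero}  (x ∷ [])     refl = (λ _ → x) , refl
enumerate {m = suc m} (x ∷ y ∷ xs) eq with q , yxs≡ ← enumerate (y ∷ xs) (cong pred eq) =
  (λ { zero → x ; (suc i) → q i }) , cong (x ∷_) yxs≡

linked-applyUpTo : ∀ {N} (G : Graph N) p {m} → Linked G (applyUpTo p (suc m)) → ∀ i → i < m → adj G (p i) (p (suc i)) ≡ true
linked-applyUpTo G p {suc m} (a , _) zero    _         = a
linked-applyUpTo G p {suc m} (_ , l) (suc i) (s≤s i<m) = linked-applyUpTo G (p ∘ suc) l i i<m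

unique-applyUpTo : ∀ {A : Set} (p : ℕ → A) {m} → Unique (applyUpTo p m) → ∀ {i j} → i < m → j < m → p i ≡ p j → i ≡ j
unique-applyUpTo p {suc m} (_ AllPairs.∷ un) {zero}  {zero}  _ _ _ = refl
unique-applyUpTo p {suc m} (d AllPairs.∷ _)  {zero}  {suc j} _ (s≤s j<m) eq = contradiction eq (All.lookup d (∈-applyUpTo⁺ (p ∘ suc) j<m))
unique-applyUpTo p {suc m} (d AllPairs.∷ _)  {suc i} {zero}  (s≤s i<m) _ eq = contradiction (sym eq) (All.lookup d (∈-applyUpTo⁺ (p ∘ suc) i<m))
unique-applyUpTo p {suc m} (_ AllPairs.∷ un) {suc i} {suc j} (s≤s i<m) (s≤s j<m) eq = cong suc (unique-applyUpTo (p ∘ suc) un i<m j<m eq)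

dist≤diam : ∀ {N} (G : Graph N) u v → dist G u v ≤ diam G
dist≤diam G u v = ≤-trans (foldr-⊔-upper (∈-map⁺ (dist G u) (∈-allFin v))) (foldr-⊔-upper (∈-map⁺ (ecc G) (∈-allFin u)))

small-maximal : ∀ {N} (G : Graph N) → IsTree G → ∀ {M d} p → DiamPath G (applyUpTo p (suc d)) → (∀ u v → dist G u v ≤ d) →
  1 ≤ length M → All (EdgeOf G (applyUpTo p (suc d))) M → (∀ M′ → IsSplitSet G M′ → length M′ ≤ length M) →
  ∀ f → Dominating G f → ∃[ g ] MaximalBnIndependent G g × cost G g ≤ cost G f + ⌈ length M + 1 /3⌉
small-maximal G (connected , acyclic) {M} {d} p diamPath@(unique , linked , _) dist≤d 1≤M edges maximum f dominating =
  Spine.Bound.bound G connected acyclic d p (linked-applyUpTo G p linked)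
    (λ i≤d j≤d → unique-applyUpTo p unique (s≤s i≤d) (s≤s j≤d)) dist≤d
    (positive d M edges 1≤M) diamPath f dominating (length M) maximum
  where
  -- A split-set contains an edge of the path, which excludes the tree with one vertex.
  positive : ∀ d M → All (EdgeOf G (applyUpTo p (suc d))) M → 1 ≤ length M → 1 ≤ d
  positive zero    (_ ∷ _) (() All.∷ _) _
  positive (suc d) _       _            _ = s≤s z≤n

theorem2p5 : ∀ {n} (T : Graph (suc n)) → IsTree T →
    (M : List (Edge T)) → IsMaximumSplitSet T M →
    (γ : ℕ) → IsBroadcastNumber T γ → γ ≢ rad T →
    (i : ℕ) → IsIbn T i →
    i ≤ γ + ⌈ length M + 1 /3⌉
theorem2p5 T tree M ((P , diamPath , edges , _ , 1≤M , _) , maximum) γ ((f , _ , dominating , cost≡γ) , _) _ i (_ , i-min) =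
  conclude (enumerate P (proj₂ (proj₂ diamPath)))
  where
  conclude : (∃[ p ] P ≡ applyUpTo p (suc (diam T))) → i ≤ γ + ⌈ length M + 1 /3⌉
  conclude (p , P≡) =
    let g , g-max , cost≤ = small-maximal T tree {M} p (subst (DiamPath T) P≡ diamPath) (dist≤diam T) 1≤M
                              (subst (λ Q → All (EdgeOf T Q) M) P≡ edges) maximum f dominating
    in ≤-trans (i-min g g-max) (≤-trans cost≤ (≡⇒≤ (cong (_+ ⌈ length M + 1 /3⌉) cost≡γ)))
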